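{- Let $\mathcal{A}=\{H_1,\dots,H_n\}$ be an indecomposable real central arrangement with $n\ge3$, $m$ a positive integer, and $\Phi:\mathbf{Ch}^m\to\mathbf{Ch}$ an admissible map whose associated maps $\varphi_j^\sigma$ all equal a single map $\varphi:B^m\to B$. Let $K=\{S\subseteq\{1,\dots,m\}\mid\varphi(S_+)=+\}$. Then (1) $\{1,\dots,m\}\in K$; (2) $S\in K$ if and only if $S^c\notin K$; (3) if $S_1\in K$ and $S_2\in K$ then $S_1\cap S_2\in K$.
   Context: $H_j=\ker\alpha_j$ with fixed linear forms $\alpha_j$ on $\mathbb{R}^\ell$, $H_j^\pm=\{x:\pm\alpha_j(x)>0\}$; $\mathbf{Ch}$ is the set of chambers. $B=\{+,-\}$ is a multiplicative group of order two; $\epsilon_j^\sigma:\mathbf{Ch}\to B$ is $\epsilon_j^\sigma(C)=\sigma\tau$ if $C\subseteq H_j^\tau$, extended componentwise to $\mathbf{Ch}^m\to B^m$. $\Phi$ is admissible if there exist maps $\varphi_j^\sigma:B^m\to B$ with $\varphi_j^\sigma(+,\dots,+)=+$ and $\epsilon_j^\sigma\circ\Phi=\varphi_j^\sigma\circ\epsilon_j^\sigma$ for all $j,\sigma$ (the associated family). For $S\subseteq\{1,\dots,m\}$, $S_+\in B^m$ has $i$-th entry $+$ if $i\in S$ and $-$ otherwise; $S^c$ is the complement in $\{1,\dots,m\}$. With $r(\mathcal{B})=\operatorname{codim}\bigcap_{H\in\mathcal{B}}H$, $\mathcal{A}$ is indecomposable if it is not a disjoint union of nonempty $\mathcal{A}_1,\mathcal{A}_2$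 with $r(\mathcal{A})=r(\mathcal{A}_1)+r(\mathcal{A}_2)$. -}

module Defs where

open import Level using (0ℓ)
open import Data.Nat using (ℕ; zero; suc; _≤_)
open import Data.Nat using () renaming (_+_ to _+ℕ_)
open import Data.Fin using (Fin; zero; suc)
open import Data.Fin.Subset using (Subset; _∈_; Side; inside; outside; ⊤; ∁; _∩_; Nonempty)
open import Data.Vec using (lookup)
open import Data.Sign using (Sign) renaming (_*_ to _·_)
open import Data.Product using (Σ; ∃; _×_; _,_)
open import Relation.Binary.PropositionalEquality using (_≡_; _≢_)
open import Relation.Binary.Structures using (IsStrictTotalOrder)
open import Algebra.Structures using (IsCommutativeRing)
open import Relation.Nullary using (¬_)
open import Data.Sum using (_⊎_)

------------------------------------------------------------------------
-- The real numbers, axiomatised as a complete ordered field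
-- (any model of these axioms is isomorphic to ℝ).

record RealField : Set₁ where
  infixl 6 _+_
  infixl 7 _*_
  infix 4 _<_ _≤ʳ_
  field
    Carrier : Set
    _+_ _*_ : Carrier → Carrier → Carrier
    -_      : Carrier → Carrier
    0# 1#   : Carrier
    _<_     : Carrier → Carrier → Set
    isCommutativeRing : IsCommutativeRing _≡_ _+_ _*_ -_ 0# 1#
    0≢1     : 0# ≢ 1#
    inverse : ∀ x → x ≢ 0# → ∃ λ y → x * y ≡ 1#
    isStrictTotalOrder : IsStrictTotalOrder _≡_ _<_
    +-mono-< : ∀ {x y} z → x < y → x + z < y + z
    *-pos    : ∀ {x y} → 0# < x → 0# < y → 0# < x * y

  _≤ʳ_ : Carrier → Carrier → Set
  x ≤ʳ y = x < y ⊎ x ≡ y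

  field
    -- least upper bound property
    complete : (P : Carrier → Set) → (∃ λ x → P x) →
               (∃ λ b → ∀ x → P x → x ≤ʳ b) →
               ∃ λ s → (∀ x → P x → x ≤ʳ s) ×
                       (∀ b → (∀ x → P x → x ≤ʳ b) → s ≤ʳ b)

------------------------------------------------------------------------
-- Linear algebra over a real field, on ℝ^ℓ = (Fin ℓ → ℝ)

module Arrangements (R : RealField) where
  open RealField R

  Vect : ℕ → Set
  Vect ℓ = Fin ℓ → Carrier

  -- finite sum
  Σᶠ : ∀ {k} → (Fin k → Carrier) → Carrier
  Σᶠ {zero}  f = 0#
  Σᶠ {suc k} f = f zero + Σᶠ (λ i → f (suc i))

  -- a linear form on ℝ^ℓ, given by its coefficient vector, applied to x
  ev : ∀ {ℓ} → Vect ℓ → Vect ℓ → Carrier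
  ev a x = Σᶠ (λ k → a k * x k)

  -- linear independence of a family v₁,…,v_d of vectors in ℝ^ℓ
  LinIndep : ∀ {ℓ d} → (Fin d → Vect ℓ) → Set
  LinIndep {ℓ} {d} v = (c : Fin d → Carrier) →
    (∀ k → Σᶠ (λ i → c i * v i k) ≡ 0#) → ∀ i → c i ≡ 0#

  -- a subspace V (given as a predicate) has dimension d
  HasDim : ∀ {ℓ} → (Vect ℓ → Set) → ℕ → Set
  HasDim {ℓ} V d =
    (Σ (Fin d → Vect ℓ) λ v → (∀ i → V (v i)) × LinIndep v) ×
    (∀ e (w : Fin e → Vect ℓ) → (∀ i → V (w i)) → LinIndep w → e ≤ d)

  -- an arrangement of n hyperplanes H_j = ker α_j in ℝ^ℓ (central: all linear)
  Forms : ℕ → ℕ → Set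
  Forms ℓ n = Fin n → Vect ℓ

  -- the α_j define n distinct hyperplanes: each α_j ≠ 0, and
  -- ker α_i ≠ ker α_j for i ≠ j (i.e. α_i is not a multiple of α_j)
  IsArrangement : ∀ {ℓ n} → Forms ℓ n → Set
  IsArrangement {ℓ} {n} α =
    (∀ j → ¬ (∀ k → α j k ≡ 0#)) ×
    (∀ i j → i ≢ j → ¬ (∃ λ c → ∀ k → α i k ≡ c * α j k))

  -- ⋂_{j ∈ S} H_j
  Inter : ∀ {ℓ n} → Forms ℓ n → Subset n → Vect ℓ → Set
  Inter α S x = ∀ j → j ∈ S → ev (α j) x ≡ 0#

  -- r(S) = codim ⋂_{j∈S} H_j  (as a relation: r(S) is r)
  Rank : ∀ {ℓ n} → Forms ℓ n → Subset n → ℕ → Set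
  Rank {ℓ} α S r = ∃ λ d → HasDim (Inter α S) d × r +ℕ d ≡ ℓ

  -- decomposable: A = A₁ ⊔ A₂, both nonempty, r(A) = r(A₁) + r(A₂)
  Decomposable : ∀ {ℓ n} → Forms ℓ n → Set
  Decomposable α = Σ _ λ S → Nonempty S × Nonempty (∁ S) ×
    (∃ λ r → ∃ λ r₁ → ∃ λ r₂ →
       Rank α ⊤ r × Rank α S r₁ × Rank α (∁ S) r₂ × r ≡ r₁ +ℕ r₂)

  Indecomposable : ∀ {ℓ n} → Forms ℓ n → Set
  Indecomposable α = ¬ Decomposable α

  -- x lies in the open half-space H_j^τ
  InHalf : Sign → Carrier → Set
  InHalf Sign.+ a = 0# < a
  InHalf Sign.- a = a < 0#

  -- chambers: the connected components of the complement, i.e. the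
  -- nonempty sets {x | α_j(x) has sign s_j for all j}, identified with
  -- their sign vector s (C ⊆ H_j^{s_j})
  IsChamber : ∀ {ℓ n} → Forms ℓ n → (Fin n → Sign) → Set
  IsChamber α s = ∃ λ x → ∀ j → InHalf (s j) (ev (α j) x)

  Ch : ∀ {ℓ n} → Forms ℓ n → Set
  Ch α = Σ _ (IsChamber α)

  -- ε_j^σ(C) = σ τ where C ⊆ H_j^τ
  ε : ∀ {ℓ n} {α : Forms ℓ n} → Fin n → Sign → Ch α → Sign
  ε j σ (s , _) = σ · s j

  allPlus : ∀ {m} → Fin m → Sign
  allPlus _ = Sign.+

  -- Φ is admissible with associated family φ_j^σ
  IsAssociatedFamily : ∀ {ℓ n m} (α : Forms ℓ n) →
    ((Fin m → Ch α) → Ch α) → (Fin n → Sign → (Fin m → Sign) → Sign) → Set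
  IsAssociatedFamily α Φ φ =
    (∀ j σ → φ j σ allPlus ≡ Sign.+) ×
    (∀ j σ (C : Fin _ → Ch α) → ε j σ (Φ C) ≡ φ j σ (λ i → ε j σ (C i)))

------------------------------------------------------------------------
-- S₊ ∈ B^m

sideSign : Side → Sign
sideSign inside  = Sign.+
sideSign outside = Sign.-

_₊ : ∀ {m} → Subset m → Fin m → Sign
(S ₊) i = sideSign (lookup S i)

-- K = {S | φ(S₊) = +}
InK : ∀ {m} → ((Fin m → Sign) → Sign) → Subset m → Set
InK φ S = φ (S ₊) ≡ Sign.+

{-# OPTIONS --safe #-}

-- An independent arrangement of at least two hyperplanes is decomposable (the first hyperplane
-- against the rest), so A has a circuit c₀ α_{h₀} + ⋯ + c_k α_{h_k} = 0 with α_{h₁}, …, α_{h_k}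
-- independent; as A has no zero and no parallel forms, two of c₁, …, c_k are nonzero besides c₀.
-- Since the same φ serves σ = + and σ = -, and ε_j^- = -ε_j^+, φ is odd.
-- Let A, B, D ∈ B^m have no coordinate shared by all three. Put A on the term z = 0, B on one
-- further nonzero term and D on all others. In every coordinate the resulting sign pattern opposes
-- term 0 to some nonzero term, so it is realised by a point off all hyperplanes: prescribe the
-- independent forms, let the relation fix the sign of term 0, and perturb slightly. Applying Φ to
-- these chambers gives a chamber in which, if φ(A) = φ(B) = φ(D) = t, every nonzero term
-- c_z α_{h_z} has sign t by oddness, contradicting the relation. The triples (S₊, S^c₊, S^c₊),
-- ((-,…,-), ⊤₊, ⊤₊) and (S₁₊, S₂₊, -(S₁∩S₂)₊) then give (2), (1) and (3).
module Submission where

open import Defs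
open import Data.Nat using (ℕ; _≤_)
open import Data.Fin using (Fin)
open import Data.Fin.Subset using (Subset; ⊤; ∁; _∩_)
open import Data.Sign using (Sign)
open import Data.Product using (_×_)
open import Relation.Nullary using (¬_)
open import Function using (_⇔_)

open import Algebra.Bundles using (CommutativeRing)
open import Data.Bool.Base using (true; false; _∧_; not)
open import Data.Empty using (⊥; ⊥-elim)
open import Data.Fin.Base using (zero; suc; splitAt; punchIn; punchOut; _↑ˡ_; _↑ʳ_)
open import Data.Fin.Properties using (any?; suc-injective; 0≢1+n; punchIn-punchOut; join-splitAt)
  renaming (_≟_ to _≟ᶠ_)
open import Data.Fin.Subset using (_∈_; ⁅_⁆)
open import Data.Fin.Subset.Properties using (∈⊤; x∈⁅x⁆; x∈⁅y⁆⇒x≡y; x∉p⇒x∈∁p; x∈∁p⇒x∉p)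
open import Data.Integer.Base as ℤ using (ℤ; 0ℤ; 1ℤ)
import Data.Integer.Properties as ℤ
import Data.Maybe.Base as Maybe
open import Data.Nat.Base as ℕ using (zero; suc; z≤n; s≤s; _∸_)
import Data.Nat.Properties as ℕ
open import Data.Product using (Σ; ∃; _,_; proj₁; proj₂)
open import Data.Sign.Base as Sign using (opposite)
import Data.Sign.Properties as Sign
open import Data.Sum using (_⊎_; inj₁; inj₂; [_,_]′)
open import Data.Sum.Properties using ([,]-map; [,]-∘)
open import Data.Unit.Base using (tt)
open import Data.Vec.Base using (lookup)
open import Data.Vec.Functional using (_++_; take; drop)
open import Data.Vec.Functional.Properties using (lookup-++ˡ; lookup-++ʳ)
open import Data.Vec.Properties using (lookup-replicate; lookup-map; lookup-zipWith)
open import Function using (mk⇔; _∘_; id)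
open import Relation.Binary.Definitions using (tri<; tri≈; tri>)
open import Relation.Binary.PropositionalEquality using (_≡_; cong)
open import Relation.Nullary.Decidable using (dec⇒maybe)

-- The ring solver of the standard library decides equalities through normal forms whose
-- coefficients must be comparable; ℤ maps into every commutative ring and has decidable equality.
module ℤ-CoefficientRingSolver {c ℓ} (R : CommutativeRing c ℓ) where
  open CommutativeRing R
  open import Data.Integer.Base using (+_; -[1+_]; _⊖_; _◃_)
  open import Algebra.Properties.Ring ring using (-0#≈0#; -‿involutive; -‿distribˡ-*; -‿distribʳ-*; -‿+-comm)
  open import Algebra.Properties.Semiring.Mult.TCOptimised semiring using (1+×; ×-homo-+; ×1-homo-*)
    renaming (_×_ to _·_)
  open import Algebra.Solver.Ring.AlmostCommutativeRing using (fromCommutativeRing; _-Raw-AlmostCommutative⟶_)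
  open import Relation.Binary.Reasoning.Setoid setoid

  fromℤ : ℤ → Carrier
  fromℤ (+ n)    = n · 1#
  fromℤ -[1+ n ] = - (suc n · 1#)

  fromℤ-neg : ∀ i → fromℤ (ℤ.- i) ≈ - fromℤ i
  fromℤ-neg (+ zero)  = sym -0#≈0#
  fromℤ-neg (+ suc n) = refl
  fromℤ-neg -[1+ n ]  = sym (-‿involutive _)

  [1+a]-[1+b]≈a-b : ∀ a b → (1# + a) + - (1# + b) ≈ a + - b
  [1+a]-[1+b]≈a-b a b = begin
    (1# + a) + - (1# + b)     ≈⟨ +-cong (+-comm 1# a) (sym (-‿+-comm 1# b)) ⟩
    (a + 1#) + (- 1# + - b)   ≈⟨ +-assoc a 1# _ ⟩
    a + (1# + (- 1# + - b))   ≈⟨ +-congˡ (sym (+-assoc 1# (- 1#) (- b))) ⟩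
    a + ((1# + - 1#) + - b)   ≈⟨ +-congˡ (+-congʳ (-‿inverseʳ 1#)) ⟩
    a + (0# + - b)            ≈⟨ +-congˡ (+-identityˡ (- b)) ⟩
    a + - b                   ∎

  fromℤ-⊖ : ∀ m n → fromℤ (m ⊖ n) ≈ m · 1# + - (n · 1#)
  fromℤ-⊖ m       zero    = sym (trans (+-congˡ -0#≈0#) (+-identityʳ _))
  fromℤ-⊖ zero    (suc n) = sym (+-identityˡ _)
  fromℤ-⊖ (suc m) (suc n) = begin
    fromℤ (suc m ⊖ suc n)             ≡⟨ cong fromℤ (ℤ.[1+m]⊖[1+n]≡m⊖n m n) ⟩
    fromℤ (m ⊖ n)                     ≈⟨ fromℤ-⊖ m n ⟩
    m · 1# + - (n · 1#)               ≈⟨ [1+a]-[1+b]≈a-b _ _ ⟨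
    (1# + m · 1#) + - (1# + n · 1#)   ≈⟨ +-cong (1+× m 1#) (-‿cong (1+× n 1#)) ⟨
    suc m · 1# + - (suc n · 1#)       ∎

  fromℤ-+ : ∀ i j → fromℤ (i ℤ.+ j) ≈ fromℤ i + fromℤ j
  fromℤ-+ (+ m)    (+ n)    = ×-homo-+ 1# m n
  fromℤ-+ (+ m)    -[1+ n ] = fromℤ-⊖ m (suc n)
  fromℤ-+ -[1+ m ] (+ n)    = trans (fromℤ-⊖ n (suc m)) (+-comm _ _)
  fromℤ-+ -[1+ m ] -[1+ n ] = begin
    - (suc (suc (m ℕ.+ n)) · 1#)      ≡⟨ cong (λ k → - (suc k · 1#)) (ℕ.+-suc m n) ⟨
    - ((suc m ℕ.+ suc n) · 1#)        ≈⟨ -‿cong (×-homo-+ 1# (suc m) (suc n)) ⟩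
    - (suc m · 1# + suc n · 1#)       ≈⟨ -‿+-comm _ _ ⟨
    - (suc m · 1#) + - (suc n · 1#)   ∎

  fromℤ-* : ∀ i j → fromℤ (i ℤ.* j) ≈ fromℤ i * fromℤ j
  fromℤ-* (+ m)    (+ n)    = trans (reflexive (cong fromℤ (ℤ.+◃n≡+n (m ℕ.* n)))) (×1-homo-* m n)
  fromℤ-* (+ m)    -[1+ n ] = begin
    fromℤ (Sign.- ◃ (m ℕ.* suc n))    ≡⟨ cong fromℤ (ℤ.-◃n≡-n (m ℕ.* suc n)) ⟩
    fromℤ (ℤ.- + (m ℕ.* suc n))       ≈⟨ fromℤ-neg (+ (m ℕ.* suc n)) ⟩
    - ((m ℕ.* suc n) · 1#)            ≈⟨ -‿cong (×1-homo-* m (suc n)) ⟩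
    - (m · 1# * suc n · 1#)           ≈⟨ -‿distribʳ-* _ _ ⟩
    m · 1# * - (suc n · 1#)           ∎
  fromℤ-* -[1+ m ] (+ n)    = begin
    fromℤ (Sign.- ◃ (suc m ℕ.* n))    ≡⟨ cong fromℤ (ℤ.-◃n≡-n (suc m ℕ.* n)) ⟩
    fromℤ (ℤ.- + (suc m ℕ.* n))       ≈⟨ fromℤ-neg (+ (suc m ℕ.* n)) ⟩
    - ((suc m ℕ.* n) · 1#)            ≈⟨ -‿cong (×1-homo-* (suc m) n) ⟩
    - (suc m · 1# * n · 1#)           ≈⟨ -‿distribˡ-* _ _ ⟩
    - (suc m · 1#) * n · 1#           ∎
  fromℤ-* -[1+ m ] -[1+ n ] = begin
    (suc m ℕ.* suc n) · 1#            ≈⟨ ×1-homo-* (suc m) (suc n) ⟩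
    suc m · 1# * suc n · 1#           ≈⟨ -‿involutive _ ⟨
    - - (suc m · 1# * suc n · 1#)     ≈⟨ -‿cong (-‿distribˡ-* _ _) ⟩
    - (- (suc m · 1#) * suc n · 1#)   ≈⟨ -‿distribʳ-* _ _ ⟩
    - (suc m · 1#) * - (suc n · 1#)   ∎

  homomorphism : ℤ.+-*-rawRing -Raw-AlmostCommutative⟶ fromCommutativeRing R
  homomorphism = record
    { ⟦_⟧    = fromℤ
    ; +-homo = fromℤ-+
    ; *-homo = fromℤ-*
    ; -‿homo = fromℤ-neg
    ; 0-homo = refl
    ; 1-homo = refl
    }

  open import Algebra.Solver.Ring ℤ.+-*-rawRing (fromCommutativeRing R) homomorphism
    (λ i j → Maybe.map (λ i≡j → reflexive (cong fromℤ i≡j)) (dec⇒maybe (i ℤ.≟ j)))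
    public

-- Opened only after the solver, whose body uses the setoid's refl, sym and trans.
open import Relation.Binary.PropositionalEquality
open import Relation.Nullary using (Dec; yes; no)
open import Relation.Nullary.Decidable using (¬?; _×-dec_; decidable-stable)
open import Relation.Unary using (Decidable)

s*[s*t]≡t : ∀ s t → s Sign.* (s Sign.* t) ≡ t
s*[s*t]≡t Sign.+ t = refl
s*[s*t]≡t Sign.- t = Sign.opposite-involutive t

[t*s]*s≡t : ∀ t s → (t Sign.* s) Sign.* s ≡ t
[t*s]*s≡t t s = trans (Sign.*-assoc t s s) (trans (cong (t Sign.*_) (Sign.s*s≡+ s)) (Sign.*-identityʳ t))

≡+⇔opposite≢+ : ∀ s → s ≡ Sign.+ ⇔ (¬ opposite s ≡ Sign.+)
≡+⇔opposite≢+ Sign.+ = mk⇔ (λ _ ()) (λ _ → refl)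
≡+⇔opposite≢+ Sign.- = mk⇔ (λ ()) (λ -≢+ → ⊥-elim (-≢+ refl))

≢⇒≡opposite : ∀ {s t} → s ≢ t → s ≡ opposite t
≢⇒≡opposite {Sign.+} {Sign.+} s≢t = ⊥-elim (s≢t refl)
≢⇒≡opposite {Sign.+} {Sign.-} _   = refl
≢⇒≡opposite {Sign.-} {Sign.+} _   = refl
≢⇒≡opposite {Sign.-} {Sign.-} s≢t = ⊥-elim (s≢t refl)

NowhereUnanimous : ∀ {m} → (A B D : Fin m → Sign) → Set
NowhereUnanimous A B D = ∀ i → B i ≡ opposite (A i) ⊎ D i ≡ opposite (A i)

⊤₊≡+ : ∀ {m} (i : Fin m) → (⊤ ₊) i ≡ Sign.+
⊤₊≡+ i = cong sideSign (lookup-replicate i true)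

∁₊≡opposite : ∀ {m} (S : Subset m) i → (∁ S ₊) i ≡ opposite ((S ₊) i)
∁₊≡opposite S i = trans (cong sideSign (lookup-map i not S)) (sideSign-not (lookup S i))
  where
  sideSign-not : ∀ b → sideSign (not b) ≡ opposite (sideSign b)
  sideSign-not true  = refl
  sideSign-not false = refl

∩₊-nowhere-unanimous : ∀ {m} (S₁ S₂ : Subset m) →
                       NowhereUnanimous (S₁ ₊) (S₂ ₊) (λ i → opposite (((S₁ ∩ S₂) ₊) i))
∩₊-nowhere-unanimous S₁ S₂ i rewrite lookup-zipWith _∧_ i S₁ S₂ = cases (lookup S₁ i) (lookup S₂ i)
  where
  cases : ∀ a b → sideSign b ≡ opposite (sideSign a) ⊎ opposite (sideSign (a ∧ b)) ≡ opposite (sideSign a)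
  cases true  true  = inj₂ refl
  cases true  false = inj₁ refl
  cases false true  = inj₁ refl
  cases false false = inj₂ refl

module OrderedField (R : RealField) where
  open RealField R public
  open Arrangements R public

  commutativeRing : CommutativeRing _ _
  commutativeRing = record { isCommutativeRing = isCommutativeRing }

  open CommutativeRing commutativeRing public
    using (+-identityˡ; +-identityʳ; *-identityˡ; *-identityʳ; zeroˡ; zeroʳ;
           +-comm; *-comm; +-assoc; distribˡ; -‿inverseʳ)
  open import Algebra.Properties.Ring (CommutativeRing.ring commutativeRing) public
    using (-0#≈0#; -‿involutive; -‿distribˡ-*; -‿distribʳ-*)
  open ℤ-CoefficientRingSolver commutativeRing public
    using (solve; _:=_; _:+_; _:*_; :-_; _:-_; con)
  open import Relation.Binary.Structures using (IsStrictTotalOrder)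
  open IsStrictTotalOrder isStrictTotalOrder public
    using (_≟_; compare) renaming (trans to <-trans)

  <-irrefl : ∀ {x} → ¬ x < x
  <-irrefl = IsStrictTotalOrder.irrefl isStrictTotalOrder refl

  <-asym : ∀ {x y} → x < y → ¬ y < x
  <-asym x<y y<x = <-irrefl (<-trans x<y y<x)

  <⇒≢ : ∀ {x y} → x < y → x ≢ y
  <⇒≢ x<y refl = <-irrefl x<y

  ≤-trans : ∀ {x y z} → x ≤ʳ y → y ≤ʳ z → x ≤ʳ z
  ≤-trans x≤y         (inj₂ refl) = x≤y
  ≤-trans (inj₂ refl) y≤z         = y≤z
  ≤-trans (inj₁ x<y)  (inj₁ y<z)  = inj₁ (<-trans x<y y<z)

  ≤-total : ∀ x y → x ≤ʳ y ⊎ y ≤ʳ x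
  ≤-total x y with compare x y
  ... | tri< x<y _ _ = inj₁ (inj₁ x<y)
  ... | tri≈ _ x≡y _ = inj₁ (inj₂ x≡y)
  ... | tri> _ _ y<x = inj₂ (inj₁ y<x)

  sgn : Sign → Carrier
  sgn Sign.+ = 1#
  sgn Sign.- = - 1#

  InClosedHalf : Sign → Carrier → Set
  InClosedHalf s a = InHalf s a ⊎ a ≡ 0#

  neg-antimono-< : ∀ {x y} → x < y → - y < - x
  neg-antimono-< {x} {y} x<y =
    subst₂ _<_ (x+[-x-y]≡-y x y) (y+[-x-y]≡-x x y) (+-mono-< (- x + - y) x<y)
    where
    x+[-x-y]≡-y : ∀ x y → x + (- x + - y) ≡ - y
    x+[-x-y]≡-y = solve 2 (λ x y → x :+ (:- x :- y) := :- y) refl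
    y+[-x-y]≡-x : ∀ x y → y + (- x + - y) ≡ - x
    y+[-x-y]≡-x = solve 2 (λ x y → y :+ (:- x :- y) := :- x) refl

  InHalf-neg : ∀ s {a} → InHalf s a → InHalf (opposite s) (- a)
  InHalf-neg Sign.+ 0<a = subst (- _ <_) -0#≈0# (neg-antimono-< 0<a)
  InHalf-neg Sign.- a<0 = subst (_< - _) -0#≈0# (neg-antimono-< a<0)

  InHalf-neg⁻ : ∀ s {a} → InHalf (opposite s) (- a) → InHalf s a
  InHalf-neg⁻ s {a} h =
    subst₂ InHalf (Sign.opposite-involutive s) (-‿involutive a) (InHalf-neg (opposite s) h)

  InHalf-≢0 : ∀ s {a} → InHalf s a → a ≢ 0#
  InHalf-≢0 Sign.+ 0<a a≡0 = <⇒≢ 0<a (sym a≡0)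
  InHalf-≢0 Sign.- a<0 a≡0 = <⇒≢ a<0 a≡0

  InHalf-unique : ∀ s t {a} → InHalf s a → InHalf t a → s ≡ t
  InHalf-unique Sign.+ Sign.+ _   _   = refl
  InHalf-unique Sign.- Sign.- _   _   = refl
  InHalf-unique Sign.+ Sign.- 0<a a<0 = ⊥-elim (<-asym 0<a a<0)
  InHalf-unique Sign.- Sign.+ a<0 0<a = ⊥-elim (<-asym 0<a a<0)

  InHalf-* : ∀ s t {a b} → InHalf s a → InHalf t b → InHalf (s Sign.* t) (a * b)
  InHalf-* Sign.+ Sign.+ 0<a 0<b = *-pos 0<a 0<b
  InHalf-* Sign.+ Sign.- {a} {b} 0<a b<0 = InHalf-neg⁻ Sign.-
    (subst (0# <_) (sym (-‿distribʳ-* a b)) (*-pos 0<a (InHalf-neg Sign.- b<0)))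
  InHalf-* Sign.- Sign.+ {a} {b} a<0 0<b = InHalf-neg⁻ Sign.-
    (subst (0# <_) (sym (-‿distribˡ-* a b)) (*-pos (InHalf-neg Sign.- a<0) 0<b))
  InHalf-* Sign.- Sign.- {a} {b} a<0 b<0 =
    subst (0# <_) (-a*-b≡a*b a b) (*-pos (InHalf-neg Sign.- a<0) (InHalf-neg Sign.- b<0))
    where
    -a*-b≡a*b : ∀ a b → - a * - b ≡ a * b
    -a*-b≡a*b = solve 2 (λ a b → :- a :* :- b := a :* b) refl

  InHalf-+ : ∀ s {a b} → InHalf s a → InClosedHalf s b → InHalf s (a + b)
  InHalf-+ s {a} ha (inj₂ refl) = subst (InHalf s) (sym (+-identityʳ a)) ha
  InHalf-+ Sign.+ {a} {b} 0<a (inj₁ 0<b) =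
    <-trans 0<a (subst₂ _<_ (+-identityˡ a) (+-comm b a) (+-mono-< a 0<b))
  InHalf-+ Sign.- {a} {b} a<0 (inj₁ b<0) =
    <-trans (subst (a + b <_) (+-identityˡ b) (+-mono-< b a<0)) b<0

  InClosedHalf-+ : ∀ s {a b} → InClosedHalf s a → InClosedHalf s b → InClosedHalf s (a + b)
  InClosedHalf-+ s (inj₁ ha) hb = inj₁ (InHalf-+ s ha hb)
  InClosedHalf-+ s {b = b} (inj₂ refl) hb = subst (InClosedHalf s) (sym (+-identityˡ b)) hb

  InClosedHalf-* : ∀ s t {a b} → InClosedHalf s a → InHalf t b → InClosedHalf (s Sign.* t) (a * b)
  InClosedHalf-* s t (inj₁ ha) hb = inj₁ (InHalf-* s t ha hb)
  InClosedHalf-* s t {b = b} (inj₂ refl) hb = inj₂ (zeroˡ b)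

  signOf : Carrier → Sign
  signOf a with compare a 0#
  ... | tri< _ _ _ = Sign.-
  ... | tri≈ _ _ _ = Sign.+
  ... | tri> _ _ _ = Sign.+

  InHalf-signOf : ∀ {a} → a ≢ 0# → InHalf (signOf a) a
  InHalf-signOf {a} a≢0 with compare a 0#
  ... | tri< a<0 _ _ = a<0
  ... | tri≈ _ a≡0 _ = ⊥-elim (a≢0 a≡0)
  ... | tri> _ _ 0<a = 0<a

  InHalf-cancelˡ : ∀ s {c a} → c ≢ 0# → InHalf s (c * a) → InHalf (signOf c Sign.* s) a
  InHalf-cancelˡ s {c} {a} c≢0 h = subst (λ t → InHalf t a) sign-a (InHalf-signOf a≢0)
    where
    a≢0 : a ≢ 0#
    a≢0 a≡0 = InHalf-≢0 s h (trans (cong (c *_) a≡0) (zeroʳ c))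
    sign-a : signOf a ≡ signOf c Sign.* s
    sign-a = trans (sym (s*[s*t]≡t (signOf c) (signOf a))) (cong (signOf c Sign.*_)
      (InHalf-unique _ s (InHalf-* (signOf c) (signOf a) (InHalf-signOf c≢0) (InHalf-signOf a≢0)) h))

  *-≢0 : ∀ {a b} → a ≢ 0# → b ≢ 0# → a * b ≢ 0#
  *-≢0 {a} {b} a≢0 b≢0 = InHalf-≢0 (signOf a Sign.* signOf b)
    (InHalf-* (signOf a) (signOf b) (InHalf-signOf a≢0) (InHalf-signOf b≢0))

  x*y≡0⇒y≡0 : ∀ {x y} → x ≢ 0# → x * y ≡ 0# → y ≡ 0#
  x*y≡0⇒y≡0 {y = y} x≢0 xy≡0 with y ≟ 0#
  ... | yes y≡0 = y≡0
  ... | no y≢0 = ⊥-elim (*-≢0 x≢0 y≢0 xy≡0)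

  0<x*x : ∀ {x} → x ≢ 0# → 0# < x * x
  0<x*x {x} x≢0 = subst (λ s → InHalf s (x * x)) (Sign.s*s≡+ (signOf x))
    (InHalf-* (signOf x) (signOf x) (InHalf-signOf x≢0) (InHalf-signOf x≢0))

  0<1 : 0# < 1#
  0<1 = subst (0# <_) (*-identityˡ 1#) (0<x*x (λ 1≡0 → 0≢1 (sym 1≡0)))

  InHalf-sgn : ∀ s → InHalf s (sgn s)
  InHalf-sgn Sign.+ = 0<1
  InHalf-sgn Sign.- = InHalf-neg Sign.+ 0<1

  inv : (x : Carrier) → x ≢ 0# → Carrier
  inv x x≢0 = proj₁ (inverse x x≢0)

  x*inv≡1 : ∀ x (x≢0 : x ≢ 0#) → x * inv x x≢0 ≡ 1#
  x*inv≡1 x x≢0 = proj₂ (inverse x x≢0)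

  0<x⇒0<inv : ∀ {x} (x≢0 : x ≢ 0#) → 0# < x → 0# < inv x x≢0
  0<x⇒0<inv {x} x≢0 0<x = subst (λ s → InHalf s i) sign≡+ (InHalf-signOf i≢0)
    where
    i = inv x x≢0
    i≢0 : i ≢ 0#
    i≢0 i≡0 = 0≢1 (trans (sym (zeroʳ x)) (trans (cong (x *_) (sym i≡0)) (x*inv≡1 x x≢0)))
    sign≡+ : signOf i ≡ Sign.+
    sign≡+ = InHalf-unique (signOf i) Sign.+
      (subst (InHalf (signOf i)) (x*inv≡1 x x≢0) (InHalf-* Sign.+ (signOf i) 0<x (InHalf-signOf i≢0)))
      0<1

  nonzero-or-zero : ∀ {k} {P : Fin k → Set} → Decidable P → (f : Fin k → Carrier) →
                    (∃ λ i → P i × f i ≢ 0#) ⊎ (∀ i → P i → f i ≡ 0#)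
  nonzero-or-zero P? f with any? (λ i → P? i ×-dec ¬? (f i ≟ 0#))
  ... | yes found = inj₁ found
  ... | no none = inj₂ λ i pᵢ → decidable-stable (f i ≟ 0#) (λ fᵢ≢0 → none (i , pᵢ , fᵢ≢0))

module FiniteSums (R : RealField) where
  open OrderedField R
  open import Algebra.Properties.Semiring.Sum (CommutativeRing.semiring commutativeRing)
    using (sum; sum-cong-≗; sum-replicate-zero; ∑-distrib-+; ∑-comm; *-distribˡ-sum)
  open ≡-Reasoning

  Σᶠ≡sum : ∀ {k} (f : Fin k → Carrier) → Σᶠ f ≡ sum f
  Σᶠ≡sum {zero}  f = refl
  Σᶠ≡sum {suc k} f = cong (f zero +_) (Σᶠ≡sum (f ∘ suc))

  Σᶠ-cong : ∀ {k} {f g : Fin k → Carrier} → (∀ i → f i ≡ g i) → Σᶠ f ≡ Σᶠ g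
  Σᶠ-cong {f = f} {g} f≗g = trans (Σᶠ≡sum f) (trans (sum-cong-≗ f≗g) (sym (Σᶠ≡sum g)))

  Σᶠ-zero : ∀ {k} {f : Fin k → Carrier} → (∀ i → f i ≡ 0#) → Σᶠ f ≡ 0#
  Σᶠ-zero {k} {f} f≗0 = trans (Σᶠ≡sum f) (trans (sum-cong-≗ f≗0) (sum-replicate-zero k))

  Σᶠ-*-zeroʳ : ∀ {k} (c f : Fin k → Carrier) → (∀ i → f i ≡ 0#) → Σᶠ (λ i → c i * f i) ≡ 0#
  Σᶠ-*-zeroʳ c f f≗0 = Σᶠ-zero (λ i → trans (cong (c i *_) (f≗0 i)) (zeroʳ (c i)))

  Σᶠ-*-zeroˡ : ∀ {k} (c f : Fin k → Carrier) → (∀ i → c i ≡ 0#) → Σᶠ (λ i → c i * f i) ≡ 0#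
  Σᶠ-*-zeroˡ c f c≗0 = Σᶠ-zero (λ i → trans (cong (_* f i) (c≗0 i)) (zeroˡ (f i)))

  Σᶠ-distrib-+ : ∀ {k} (f g : Fin k → Carrier) → Σᶠ (λ i → f i + g i) ≡ Σᶠ f + Σᶠ g
  Σᶠ-distrib-+ f g = begin
    Σᶠ (λ i → f i + g i)   ≡⟨ Σᶠ≡sum (λ i → f i + g i) ⟩
    sum (λ i → f i + g i)  ≡⟨ ∑-distrib-+ f g ⟩
    sum f + sum g          ≡⟨ cong₂ _+_ (Σᶠ≡sum f) (Σᶠ≡sum g) ⟨
    Σᶠ f + Σᶠ g            ∎

  *-distribˡ-Σᶠ : ∀ {k} x (f : Fin k → Carrier) → x * Σᶠ f ≡ Σᶠ (λ i → x * f i)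
  *-distribˡ-Σᶠ x f = begin
    x * Σᶠ f               ≡⟨ cong (x *_) (Σᶠ≡sum f) ⟩
    x * sum f              ≡⟨ *-distribˡ-sum x f ⟩
    sum (λ i → x * f i)    ≡⟨ Σᶠ≡sum (λ i → x * f i) ⟨
    Σᶠ (λ i → x * f i)     ∎

  Σᶠ-comm : ∀ {k e} (f : Fin k → Fin e → Carrier) →
            Σᶠ (λ i → Σᶠ (λ j → f i j)) ≡ Σᶠ (λ j → Σᶠ (λ i → f i j))
  Σᶠ-comm f = begin
    Σᶠ (λ i → Σᶠ (f i))             ≡⟨ Σᶠ-cong (λ i → Σᶠ≡sum (f i)) ⟩
    Σᶠ (λ i → sum (f i))            ≡⟨ Σᶠ≡sum (λ i → sum (f i)) ⟩
    sum (λ i → sum (f i))           ≡⟨ ∑-comm f ⟩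
    sum (λ j → sum (λ i → f i j))   ≡⟨ Σᶠ≡sum (λ j → sum (λ i → f i j)) ⟨
    Σᶠ (λ j → sum (λ i → f i j))    ≡⟨ Σᶠ-cong (λ j → Σᶠ≡sum (λ i → f i j)) ⟨
    Σᶠ (λ j → Σᶠ (λ i → f i j))     ∎

  Σᶠ-++ : ∀ {k e} (f : Fin k → Carrier) (g : Fin e → Carrier) → Σᶠ (f ++ g) ≡ Σᶠ f + Σᶠ g
  Σᶠ-++ {zero}  f g = sym (+-identityˡ (Σᶠ g))
  Σᶠ-++ {suc k} f g = begin
    f zero + Σᶠ (λ i → (f ++ g) (suc i))   ≡⟨ cong (f zero +_) (Σᶠ-cong (λ i → [,]-map (splitAt k i))) ⟩
    f zero + Σᶠ ((f ∘ suc) ++ g)           ≡⟨ cong (f zero +_) (Σᶠ-++ (f ∘ suc) g) ⟩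
    f zero + (Σᶠ (f ∘ suc) + Σᶠ g)         ≡⟨ +-assoc _ _ _ ⟨
    Σᶠ f + Σᶠ g                            ∎

  Σᶠ-single : ∀ {k} (f : Fin k → Carrier) i → (∀ j → j ≢ i → f j ≡ 0#) → Σᶠ f ≡ f i
  Σᶠ-single f zero    f≗0 =
    trans (cong (f zero +_) (Σᶠ-zero (λ j → f≗0 (suc j) λ ()))) (+-identityʳ (f zero))
  Σᶠ-single f (suc i) f≗0 =
    trans (cong₂ _+_ (f≗0 zero λ ()) (Σᶠ-single (f ∘ suc) i tail≗0)) (+-identityˡ (f (suc i)))
    where
    tail≗0 : ∀ j → j ≢ i → f (suc j) ≡ 0#
    tail≗0 j j≢i = f≗0 (suc j) (j≢i ∘ suc-injective)

  Σᶠ-InClosedHalf : ∀ s {k} (f : Fin k → Carrier) → (∀ i → InClosedHalf s (f i)) → InClosedHalf s (Σᶠ f)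
  Σᶠ-InClosedHalf s {zero}  f hf = inj₂ refl
  Σᶠ-InClosedHalf s {suc k} f hf = InClosedHalf-+ s (hf zero) (Σᶠ-InClosedHalf s (f ∘ suc) (hf ∘ suc))

  Σᶠ-InHalf : ∀ s {k} (f : Fin k → Carrier) i → (∀ j → InClosedHalf s (f j)) → InHalf s (f i) →
              InHalf s (Σᶠ f)
  Σᶠ-InHalf s f zero    hf hi = InHalf-+ s hi (Σᶠ-InClosedHalf s (f ∘ suc) (hf ∘ suc))
  Σᶠ-InHalf s f (suc i) hf hi =
    subst (InHalf s) (+-comm _ (f zero)) (InHalf-+ s (Σᶠ-InHalf s (f ∘ suc) i (hf ∘ suc) hi) (hf zero))

module Vectors (R : RealField) where
  open OrderedField R
  open FiniteSums R
  open ≡-Reasoning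

  infixl 6 _+ᵛ_
  infixr 7 _*ᵛ_

  _+ᵛ_ : ∀ {ℓ} → Vect ℓ → Vect ℓ → Vect ℓ
  (x +ᵛ y) q = x q + y q

  _*ᵛ_ : ∀ {ℓ} → Carrier → Vect ℓ → Vect ℓ
  (c *ᵛ x) q = c * x q

  lin : ∀ {e ℓ} → (Fin e → Carrier) → (Fin e → Vect ℓ) → Vect ℓ
  lin c v q = Σᶠ (λ i → c i * v i q)

  ev-comm : ∀ {ℓ} (a x : Vect ℓ) → ev a x ≡ ev x a
  ev-comm a x = Σᶠ-cong (λ q → *-comm (a q) (x q))

  ev-+ᵛ : ∀ {ℓ} (a x y : Vect ℓ) → ev a (x +ᵛ y) ≡ ev a x + ev a y
  ev-+ᵛ a x y = trans (Σᶠ-cong (λ q → distribˡ (a q) (x q) (y q)))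
                      (Σᶠ-distrib-+ (λ q → a q * x q) (λ q → a q * y q))

  ev-*ᵛ : ∀ {ℓ} (a : Vect ℓ) c x → ev a (c *ᵛ x) ≡ c * ev a x
  ev-*ᵛ a c x = begin
    Σᶠ (λ q → a q * (c * x q))  ≡⟨ Σᶠ-cong (λ q → a*[c*x]≡c*[a*x] (a q) c (x q)) ⟩
    Σᶠ (λ q → c * (a q * x q))  ≡⟨ *-distribˡ-Σᶠ c (λ q → a q * x q) ⟨
    c * ev a x                  ∎
    where
    a*[c*x]≡c*[a*x] : ∀ a c x → a * (c * x) ≡ c * (a * x)
    a*[c*x]≡c*[a*x] = solve 3 (λ a c x → a :* (c :* x) := c :* (a :* x)) refl

  ev-lin : ∀ {e ℓ} (a : Vect ℓ) (c : Fin e → Carrier) (v : Fin e → Vect ℓ) →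
           ev a (lin c v) ≡ Σᶠ (λ i → c i * ev a (v i))
  ev-lin a c v = begin
    Σᶠ (λ q → a q * Σᶠ (λ i → c i * v i q))
      ≡⟨ Σᶠ-cong (λ q → *-distribˡ-Σᶠ (a q) (λ i → c i * v i q)) ⟩
    Σᶠ (λ q → Σᶠ (λ i → a q * (c i * v i q)))
      ≡⟨ Σᶠ-comm (λ q i → a q * (c i * v i q)) ⟩
    Σᶠ (λ i → Σᶠ (λ q → a q * (c i * v i q)))
      ≡⟨ Σᶠ-cong (λ i → ev-*ᵛ a (c i) (v i)) ⟩
    Σᶠ (λ i → c i * ev a (v i)) ∎

  0<ev-self : ∀ {ℓ} (x : Vect ℓ) q → x q ≢ 0# → 0# < ev x x
  0<ev-self x q xq≢0 = Σᶠ-InHalf Sign.+ (λ p → x p * x p) q square-nonneg (0<x*x xq≢0)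
    where
    square-nonneg : ∀ p → InClosedHalf Sign.+ (x p * x p)
    square-nonneg p with x p ≟ 0#
    ... | yes xp≡0 = inj₂ (trans (cong (x p *_) xp≡0) (zeroʳ (x p)))
    ... | no xp≢0  = inj₁ (0<x*x xp≢0)

  ev-self≡0 : ∀ {ℓ} (x : Vect ℓ) → ev x x ≡ 0# → ∀ q → x q ≡ 0#
  ev-self≡0 x xx≡0 q with x q ≟ 0#
  ... | yes xq≡0 = xq≡0
  ... | no xq≢0  = ⊥-elim (InHalf-≢0 Sign.+ (0<ev-self x q xq≢0) xx≡0)

module LinearIndependence (R : RealField) where
  open OrderedField R
  open FiniteSums R
  open Vectors R
  open ≡-Reasoning

  Dependent : ∀ {e ℓ} → (Fin e → Vect ℓ) → Set
  Dependent v = ∃ λ c → (∃ λ i → c i ≢ 0#) × (∀ q → lin c v q ≡ 0#)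

  LinIndep⇒¬Dependent : ∀ {e ℓ} {v : Fin e → Vect ℓ} → LinIndep v → ¬ Dependent v
  LinIndep⇒¬Dependent indep (c , (i , cᵢ≢0) , c·v≡0) = cᵢ≢0 (indep c c·v≡0 i)

  module Elimination {e k} (v : Fin (suc e) → Vect (suc k)) (r : Fin (suc k)) (pivot≢0 : v zero r ≢ 0#) where

    multiplier : Fin e → Carrier
    multiplier i = v (suc i) r * inv (v zero r) pivot≢0

    reduced : Fin e → Vect (suc k)
    reduced i q = v (suc i) q + - (multiplier i * v zero q)

    reduced-pivot : ∀ i → reduced i r ≡ 0#
    reduced-pivot i = begin
      b + - (b * p * a)      ≡⟨ solve 3 (λ b p a → b :- b :* p :* a := b :- b :* (a :* p)) refl b p a ⟩
      b + - (b * (a * p))    ≡⟨ cong (λ x → b + - (b * x)) (x*inv≡1 a pivot≢0) ⟩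
      b + - (b * 1#)         ≡⟨ solve 1 (λ b → b :- b :* con 1ℤ := con 0ℤ) refl b ⟩
      0#                     ∎
      where a = v zero r; b = v (suc i) r; p = inv a pivot≢0

    reducedᵣ : Fin e → Vect k
    reducedᵣ i = reduced i ∘ punchIn r

    extend : (Fin e → Carrier) → Fin (suc e) → Carrier
    extend c zero    = - Σᶠ (λ i → c i * multiplier i)
    extend c (suc i) = c i

    lin-extend : ∀ c q → lin (extend c) v q ≡ lin c reduced q
    lin-extend c q = begin
      - M * v₀ + S
        ≡⟨ solve 3 (λ M v₀ S → :- M :* v₀ :+ S := S :+ :- v₀ :* M) refl M v₀ S ⟩
      S + - v₀ * M
        ≡⟨ cong (S +_) (*-distribˡ-Σᶠ (- v₀) (λ i → c i * multiplier i)) ⟩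
      S + Σᶠ (λ i → - v₀ * (c i * multiplier i))
        ≡⟨ Σᶠ-distrib-+ (λ i → c i * v (suc i) q) (λ i → - v₀ * (c i * multiplier i)) ⟨
      Σᶠ (λ i → c i * v (suc i) q + - v₀ * (c i * multiplier i))
        ≡⟨ Σᶠ-cong (λ i → solve 4 (λ c b μ v₀ → c :* b :+ :- v₀ :* (c :* μ) := c :* (b :- μ :* v₀))
                                  refl (c i) (v (suc i) q) (multiplier i) v₀) ⟩
      lin c reduced q ∎
      where M = Σᶠ (λ i → c i * multiplier i); v₀ = v zero q; S = Σᶠ (λ i → c i * v (suc i) q)

    dependent-lift : Dependent reducedᵣ → Dependent v
    dependent-lift (c , (i , cᵢ≢0) , c·w≡0) =
      extend c , (suc i , cᵢ≢0) , λ q → trans (lin-extend c q) (c·reduced≡0 q)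
      where
      c·reduced≡0 : ∀ q → lin c reduced q ≡ 0#
      c·reduced≡0 q with r ≟ᶠ q
      ... | yes refl = Σᶠ-*-zeroʳ c (λ i → reduced i r) reduced-pivot
      ... | no r≢q   = subst (λ q → lin c reduced q ≡ 0#) (punchIn-punchOut r≢q) (c·w≡0 (punchOut r≢q))

    independent-lift : LinIndep reducedᵣ → LinIndep v
    independent-lift indep c c·v≡0 = c≡0
      where
      a = v zero r
      p = inv a pivot≢0
      S = Σᶠ (λ i → c (suc i) * v (suc i) r)

      Σcμ≡p*S : Σᶠ (λ i → c (suc i) * multiplier i) ≡ p * S
      Σcμ≡p*S = trans (Σᶠ-cong (λ i → c*[b*p]≡p*[c*b] (c (suc i)) (v (suc i) r) p))
                      (sym (*-distribˡ-Σᶠ p (λ i → c (suc i) * v (suc i) r)))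
        where
        c*[b*p]≡p*[c*b] : ∀ c b p → c * (b * p) ≡ p * (c * b)
        c*[b*p]≡p*[c*b] = solve 3 (λ c b p → c :* (b :* p) := p :* (c :* b)) refl

      extend-tail≡c₀ : extend (c ∘ suc) zero ≡ c zero
      extend-tail≡c₀ = begin
        - Σᶠ (λ i → c (suc i) * multiplier i)
          ≡⟨ cong -_ Σcμ≡p*S ⟩
        - (p * S)
          ≡⟨ solve 4 (λ p S c₀ a → :- (p :* S) := :- (p :* (c₀ :* a :+ S)) :+ c₀ :* (a :* p)) refl p S (c zero) a ⟩
        - (p * (c zero * a + S)) + c zero * (a * p)
          ≡⟨ cong₂ (λ x y → - (p * x) + c zero * y) (c·v≡0 r) (x*inv≡1 a pivot≢0) ⟩
        - (p * 0#) + c zero * 1#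
          ≡⟨ solve 2 (λ p c₀ → :- (p :* con 0ℤ) :+ c₀ :* con 1ℤ := c₀) refl p (c zero) ⟩
        c zero ∎

      reduced-relation : ∀ q → lin (c ∘ suc) reduced q ≡ 0#
      reduced-relation q = begin
        lin (c ∘ suc) reduced q      ≡⟨ lin-extend (c ∘ suc) q ⟨
        lin (extend (c ∘ suc)) v q   ≡⟨ cong (λ x → x * v zero q + lin (c ∘ suc) (v ∘ suc) q) extend-tail≡c₀ ⟩
        lin c v q                    ≡⟨ c·v≡0 q ⟩
        0#                           ∎

      tail≡0 : ∀ i → c (suc i) ≡ 0#
      tail≡0 = indep (c ∘ suc) (reduced-relation ∘ punchIn r)

      c≡0 : ∀ i → c i ≡ 0#
      c≡0 zero = begin
        c zero                                   ≡⟨ extend-tail≡c₀ ⟨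
        - Σᶠ (λ i → c (suc i) * multiplier i)    ≡⟨ cong -_ (Σᶠ-*-zeroˡ (c ∘ suc) multiplier tail≡0) ⟩
        - 0#                                     ≡⟨ -0#≈0# ⟩
        0#                                       ∎
      c≡0 (suc i) = tail≡0 i

  independent-or-dependent : ∀ {k} e (v : Fin e → Vect k) → (LinIndep v × e ≤ k) ⊎ Dependent v
  independent-or-dependent zero v = inj₁ ((λ c _ ()) , z≤n)
  independent-or-dependent (suc e) v with nonzero-or-zero (λ _ → yes tt) (v zero)
  ... | inj₂ v₀≡0 = inj₂ (unit , (zero , λ 1≡0 → 0≢1 (sym 1≡0)) , unit·v≡0)
    where
    unit : Fin (suc e) → Carrier
    unit zero    = 1#
    unit (suc i) = 0#
    unit·v≡0 : ∀ q → lin unit v q ≡ 0#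
    unit·v≡0 q = trans (cong₂ _+_ (trans (cong (1# *_) (v₀≡0 q tt)) (zeroʳ 1#))
                                  (Σᶠ-*-zeroˡ (unit ∘ suc) (λ i → v (suc i) q) (λ _ → refl)))
                       (+-identityʳ 0#)
  independent-or-dependent {suc k} (suc e) v | inj₁ (r , _ , pivot≢0)
    with independent-or-dependent e (Elimination.reducedᵣ v r pivot≢0)
  ... | inj₁ (indep , e≤k) = inj₁ (Elimination.independent-lift v r pivot≢0 indep , s≤s e≤k)
  ... | inj₂ dep           = inj₂ (Elimination.dependent-lift v r pivot≢0 dep)

  LinIndep⇒≤ : ∀ {e ℓ} (v : Fin e → Vect ℓ) → LinIndep v → e ≤ ℓ
  LinIndep⇒≤ {e} v indep with independent-or-dependent e v
  ... | inj₁ (_ , e≤ℓ) = e≤ℓ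
  ... | inj₂ dep       = ⊥-elim (LinIndep⇒¬Dependent indep dep)

  >⇒Dependent : ∀ {e ℓ} (v : Fin e → Vect ℓ) → ℓ ℕ.< e → Dependent v
  >⇒Dependent {e} v ℓ<e with independent-or-dependent e v
  ... | inj₁ (_ , e≤ℓ) = ⊥-elim (ℕ.<⇒≱ ℓ<e e≤ℓ)
  ... | inj₂ dep       = dep

  LinIndep-single : ∀ {ℓ} (x : Vect ℓ) q → x q ≢ 0# → LinIndep (λ (_ : Fin 1) → x)
  LinIndep-single x q xq≢0 c c·x≡0 zero =
    x*y≡0⇒y≡0 xq≢0 (trans (*-comm (x q) (c zero)) (trans (sym (+-identityʳ _)) (c·x≡0 q)))

  LinIndep-head : ∀ {e ℓ} (v : Fin (suc e) → Vect ℓ) → LinIndep v → LinIndep (λ (_ : Fin 1) → v zero)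
  LinIndep-head v indep c c·v₀≡0 zero = indep c′ c′·v≡0 zero
    where
    c′ : Fin _ → Carrier
    c′ zero    = c zero
    c′ (suc _) = 0#
    c′·v≡0 : ∀ q → lin c′ v q ≡ 0#
    c′·v≡0 q = trans (cong (c zero * v zero q +_) (Σᶠ-zero (λ i → zeroˡ (v (suc i) q)))) (c·v₀≡0 q)

  LinIndep-tail : ∀ {e ℓ} (v : Fin (suc e) → Vect ℓ) → LinIndep v → LinIndep (v ∘ suc)
  LinIndep-tail v indep c c·v≡0 i = indep c′ c′·v≡0 (suc i)
    where
    c′ : Fin _ → Carrier
    c′ zero    = 0#
    c′ (suc i) = c i
    c′·v≡0 : ∀ q → lin c′ v q ≡ 0#
    c′·v≡0 q = trans (cong (_+ lin c (v ∘ suc) q) (zeroˡ (v zero q))) (trans (+-identityˡ _) (c·v≡0 q))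

  take++drop≗id : ∀ {A : Set} a {b} (c : Fin (a ℕ.+ b) → A) i → (take a c ++ drop a c) i ≡ c i
  take++drop≗id a {b} c i = trans (sym ([,]-∘ c (splitAt a i))) (cong c (join-splitAt a b i))

  lin-++ : ∀ {a b ℓ} (c : Fin a → Carrier) (d : Fin b → Carrier) (u : Fin a → Vect ℓ) (v : Fin b → Vect ℓ) q →
           lin (c ++ d) (u ++ v) q ≡ lin c u q + lin d v q
  lin-++ {a} c d u v q = trans (Σᶠ-cong termwise) (Σᶠ-++ (λ i → c i * u i q) (λ j → d j * v j q))
    where
    termwise : ∀ i → (c ++ d) i * (u ++ v) i q ≡ ((λ i → c i * u i q) ++ (λ j → d j * v j q)) i
    termwise i with splitAt a i
    ... | inj₁ _ = refl
    ... | inj₂ _ = refl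

  -- If U + V = 0 with U ⊥ V, then ev U U = ev U (U + V) = 0, so U = 0 and hence V = 0.
  LinIndep-++ : ∀ {a b ℓ} (u : Fin a → Vect ℓ) (v : Fin b → Vect ℓ) → LinIndep u → LinIndep v →
                (∀ i j → ev (u i) (v j) ≡ 0#) → LinIndep (u ++ v)
  LinIndep-++ {a} {b} u v indep-u indep-v u⊥v c c·uv≡0 i =
    trans (sym (take++drop≗id a c i)) (coefficient≡0 (splitAt a i))
    where
    d = take a c
    d′ = drop a c
    U = lin d u
    V = lin d′ v

    U+V≡0 : ∀ q → U q + V q ≡ 0#
    U+V≡0 q = trans (sym (lin-++ d d′ u v q))
                    (trans (Σᶠ-cong (λ i → cong (_* (u ++ v) i q) (take++drop≗id a c i))) (c·uv≡0 q))

    v⊥U : ∀ j → ev (v j) U ≡ 0#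
    v⊥U j = trans (ev-lin (v j) d u)
                  (Σᶠ-*-zeroʳ d (λ i → ev (v j) (u i)) (λ i → trans (ev-comm (v j) (u i)) (u⊥v i j)))

    U⊥V : ev U V ≡ 0#
    U⊥V = trans (ev-lin U d′ v) (Σᶠ-*-zeroʳ d′ (λ j → ev U (v j)) (λ j → trans (ev-comm U (v j)) (v⊥U j)))

    U≡0 : ∀ q → U q ≡ 0#
    U≡0 = ev-self≡0 U (begin
      ev U U                 ≡⟨ +-identityʳ (ev U U) ⟨
      ev U U + 0#            ≡⟨ cong (ev U U +_) U⊥V ⟨
      ev U U + ev U V        ≡⟨ ev-+ᵛ U U V ⟨
      ev U (U +ᵛ V)          ≡⟨ Σᶠ-*-zeroʳ U (U +ᵛ V) U+V≡0 ⟩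
      0#                     ∎)

    V≡0 : ∀ q → V q ≡ 0#
    V≡0 q = trans (sym (+-identityˡ (V q))) (trans (cong (_+ V q) (sym (U≡0 q))) (U+V≡0 q))

    coefficient≡0 : ∀ s → [ d , d′ ]′ s ≡ 0#
    coefficient≡0 (inj₁ j) = indep-u d U≡0 j
    coefficient≡0 (inj₂ j) = indep-v d′ V≡0 j

  -- A relation y₀ t + Σ yⱼ Gⱼ = 0 between t and the columns of the Gram matrix G of γ has y₀ ≠ 0,
  -- because G is nonsingular; then x = -y₀⁻¹ Σ yⱼ γⱼ solves γ(x) = t.
  solve-linear-system : ∀ {k ℓ} (γ : Fin k → Vect ℓ) → LinIndep γ → (t : Fin k → Carrier) →
                        ∃ λ x → ∀ i → ev (γ i) x ≡ t i
  solve-linear-system {k} γ indep t with >⇒Dependent columns ℕ.≤-refl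
    where
    columns : Fin (suc k) → Vect k
    columns zero    r = t r
    columns (suc j) r = ev (γ r) (γ j)
  ... | y , (i , yᵢ≢0) , y·columns≡0 with y zero ≟ 0#
  ...   | yes y₀≡0 = ⊥-elim (yᵢ≢0 (y≡0 i))
    where
    G = lin (y ∘ suc) γ
    γ⊥G : ∀ r → ev (γ r) G ≡ 0#
    γ⊥G r = begin
      ev (γ r) G                  ≡⟨ ev-lin (γ r) (y ∘ suc) γ ⟩
      S                           ≡⟨ +-identityˡ S ⟨
      0# + S                      ≡⟨ cong (_+ S) (trans (cong (_* t r) y₀≡0) (zeroˡ (t r))) ⟨
      y zero * t r + S            ≡⟨ y·columns≡0 r ⟩
      0#                          ∎
      where S = Σᶠ (λ j → y (suc j) * ev (γ r) (γ j))
    G≡0 : ∀ q → G q ≡ 0#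
    G≡0 = ev-self≡0 G (trans (ev-lin G (y ∘ suc) γ)
                             (Σᶠ-*-zeroʳ (y ∘ suc) (λ r → ev G (γ r)) (λ r → trans (ev-comm G (γ r)) (γ⊥G r))))
    y≡0 : ∀ i → y i ≡ 0#
    y≡0 zero    = y₀≡0
    y≡0 (suc j) = indep (y ∘ suc) G≡0 j
  ...   | no y₀≢0 = (- p) *ᵛ lin (y ∘ suc) γ , solves
    where
    p = inv (y zero) y₀≢0
    solves : ∀ r → ev (γ r) ((- p) *ᵛ lin (y ∘ suc) γ) ≡ t r
    solves r = begin
      ev (γ r) ((- p) *ᵛ lin (y ∘ suc) γ)
        ≡⟨ ev-*ᵛ (γ r) (- p) _ ⟩
      - p * ev (γ r) (lin (y ∘ suc) γ)
        ≡⟨ cong (- p *_) (ev-lin (γ r) (y ∘ suc) γ) ⟩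
      - p * S
        ≡⟨ solve 4 (λ p S y₀ t → :- p :* S := :- p :* (y₀ :* t :+ S) :+ (y₀ :* p) :* t) refl p S (y zero) (t r) ⟩
      - p * (y zero * t r + S) + y zero * p * t r
        ≡⟨ cong₂ (λ a b → - p * a + b * t r) (y·columns≡0 r) (x*inv≡1 (y zero) y₀≢0) ⟩
      - p * 0# + 1# * t r
        ≡⟨ solve 2 (λ p t → :- p :* con 0ℤ :+ con 1ℤ :* t := t) refl p (t r) ⟩
      t r ∎
      where S = Σᶠ (λ j → y (suc j) * ev (γ r) (γ j))

module Kernels (R : RealField) where
  open OrderedField R
  open Vectors R
  open LinearIndependence R

  Kernel : ∀ {k ℓ} → (Fin k → Vect ℓ) → Vect ℓ → Set
  Kernel β x = ∀ i → ev (β i) x ≡ 0#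

  -- A nonzero x orthogonal to β ++ w exists as long as k + t < ℓ: it is a relation among the ℓ columns.
  kernel-basis : ∀ {k ℓ} (β : Fin k → Vect ℓ) → LinIndep β → ∀ t → k ℕ.+ t ≤ ℓ →
                 Σ (Fin t → Vect ℓ) λ w → (∀ i → Kernel β (w i)) × LinIndep w
  kernel-basis β indep zero _ = (λ ()) , (λ ()) , (λ c _ ())
  kernel-basis {k} {ℓ} β indep (suc t) k+t<ℓ
    with kernel-basis β indep t (ℕ.<⇒≤ (subst (_≤ ℓ) (ℕ.+-suc k t) k+t<ℓ))
  ... | w , w∈ker , indep-w =
    (λ _ → x) ++ w , x∷w∈ker , LinIndep-++ (λ _ → x) w (LinIndep-single x q xq≢0) indep-w (λ _ → x⊥w)
    where
    rows : Fin (k ℕ.+ t) → Vect ℓ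
    rows = β ++ w
    dep : Dependent (λ q r → rows r q)
    dep = >⇒Dependent (λ q r → rows r q) (subst (_≤ ℓ) (ℕ.+-suc k t) k+t<ℓ)
    x = proj₁ dep
    q = proj₁ (proj₁ (proj₂ dep))
    xq≢0 = proj₂ (proj₁ (proj₂ dep))
    rows⊥x : ∀ r → ev (rows r) x ≡ 0#
    rows⊥x r = trans (ev-comm (rows r) x) (proj₂ (proj₂ dep) r)
    x∷w∈ker : ∀ i → Kernel β (((λ _ → x) ++ w) i)
    x∷w∈ker zero i    = subst (λ a → ev a x ≡ 0#) (lookup-++ˡ β w i) (rows⊥x (i ↑ˡ t))
    x∷w∈ker (suc j)   = w∈ker j
    x⊥w : ∀ j → ev x (w j) ≡ 0#
    x⊥w j = trans (ev-comm x (w j)) (subst (λ a → ev a x ≡ 0#) (lookup-++ʳ β w j) (rows⊥x (k ↑ʳ j)))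

  kernel-dim : ∀ {k ℓ} (β : Fin k → Vect ℓ) → LinIndep β → HasDim (Kernel β) (ℓ ∸ k)
  kernel-dim {k} {ℓ} β indep =
    kernel-basis β indep (ℓ ∸ k) (ℕ.≤-reflexive (ℕ.m+[n∸m]≡n (LinIndep⇒≤ β indep))) , bound
    where
    bound : ∀ e (w : Fin e → Vect ℓ) → (∀ i → Kernel β (w i)) → LinIndep w → e ≤ ℓ ∸ k
    bound e w w∈ker indep-w = ℕ.m+n≤o⇒m≤o∸n e (subst (_≤ ℓ) (ℕ.+-comm k e)
      (LinIndep⇒≤ (β ++ w) (LinIndep-++ β w indep indep-w (λ i j → w∈ker j i))))

  HasDim-cong : ∀ {ℓ d} {V W : Vect ℓ → Set} → (∀ x → V x → W x) → (∀ x → W x → V x) →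
                HasDim V d → HasDim W d
  HasDim-cong V⊆W W⊆V ((v , v∈V , indep) , bound) =
    (v , (λ i → V⊆W _ (v∈V i)) , indep) , (λ e w w∈W → bound e w (λ i → W⊆V _ (w∈W i)))

  Rank-independent : ∀ {k ℓ n} (α : Forms ℓ n) (S : Subset n) (β : Fin k → Vect ℓ) → LinIndep β →
                     (∀ x → Kernel β x → Inter α S x) → (∀ x → Inter α S x → Kernel β x) → Rank α S k
  Rank-independent {k} {ℓ} α S β indep ker⊆inter inter⊆ker =
    ℓ ∸ k , HasDim-cong ker⊆inter inter⊆ker (kernel-dim β indep) , ℕ.m+[n∸m]≡n (LinIndep⇒≤ β indep)

  independent⇒decomposable : ∀ {ℓ n} (α : Forms ℓ (suc (suc n))) → LinIndep α → Decomposable α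
  independent⇒decomposable {n = n} α indep =
    ⁅ zero ⁆ , (zero , x∈⁅x⁆ zero) , (suc zero , suc∈∁⁅zero⁆) ,
    (suc (suc n) , 1 , suc n , rank-⊤ , rank-first , rank-rest , refl)
    where
    suc∈∁⁅zero⁆ : ∀ {i : Fin (suc n)} → suc i ∈ ∁ ⁅ zero ⁆
    suc∈∁⁅zero⁆ = x∉p⇒x∈∁p (λ suc∈⁅0⁆ → 0≢1+n (sym (x∈⁅y⁆⇒x≡y zero suc∈⁅0⁆)))

    rank-⊤ : Rank α ⊤ (suc (suc n))
    rank-⊤ = Rank-independent α ⊤ α indep (λ x x∈ker j _ → x∈ker j) (λ x x∈inter j → x∈inter j ∈⊤)

    rank-first : Rank α ⁅ zero ⁆ 1
    rank-first = Rank-independent α ⁅ zero ⁆ (λ _ → α zero) (LinIndep-head α indep) ker⊆inter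
                                  (λ x x∈inter _ → x∈inter zero (x∈⁅x⁆ zero))
      where
      ker⊆inter : ∀ x → Kernel (λ _ → α zero) x → Inter α ⁅ zero ⁆ x
      ker⊆inter x x∈ker j j∈⁅0⁆ = subst (λ j → ev (α j) x ≡ 0#) (sym (x∈⁅y⁆⇒x≡y zero j∈⁅0⁆)) (x∈ker zero)

    rank-rest : Rank α (∁ ⁅ zero ⁆) (suc n)
    rank-rest = Rank-independent α (∁ ⁅ zero ⁆) (α ∘ suc) (LinIndep-tail α indep) ker⊆inter
                                 (λ x x∈inter i → x∈inter (suc i) suc∈∁⁅zero⁆)
      where
      ker⊆inter : ∀ x → Kernel (α ∘ suc) x → Inter α (∁ ⁅ zero ⁆) x
      ker⊆inter x x∈ker zero    0∈∁ = ⊥-elim (x∈∁p⇒x∉p 0∈∁ (x∈⁅x⁆ zero))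
      ker⊆inter x x∈ker (suc i) _   = x∈ker i

module Circuits (R : RealField) where
  open OrderedField R
  open FiniteSums R
  open Vectors R
  open LinearIndependence R
  open Kernels R
  open ≡-Reasoning

  record Circuit {e ℓ} (v : Fin e → Vect ℓ) : Set where
    field
      k           : ℕ
      h           : Fin (suc k) → Fin e
      h-injective : ∀ {z z′} → h z ≡ h z′ → z ≡ z′
      c           : Fin (suc k) → Carrier
      c₀≢0        : c zero ≢ 0#
      relation    : ∀ q → lin c (v ∘ h) q ≡ 0#
      independent : LinIndep (v ∘ h ∘ suc)

  independent-or-circuit : ∀ {ℓ} e (v : Fin e → Vect ℓ) → LinIndep v ⊎ Circuit v
  independent-or-circuit zero v = inj₁ (λ c _ ())
  independent-or-circuit (suc e) v with independent-or-circuit e (v ∘ suc)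
  ... | inj₂ C = inj₂ record
    { k = k ; h = suc ∘ h ; h-injective = h-injective ∘ suc-injective
    ; c = c ; c₀≢0 = c₀≢0 ; relation = relation ; independent = independent }
    where open Circuit C
  ... | inj₁ indep-tail with independent-or-dependent (suc e) v
  ...   | inj₁ (indep , _) = inj₁ indep
  ...   | inj₂ (c , (i , cᵢ≢0) , c·v≡0) with c zero ≟ 0#
  ...     | no c₀≢0 = inj₂ record
    { k = e ; h = id ; h-injective = id
    ; c = c ; c₀≢0 = c₀≢0 ; relation = c·v≡0 ; independent = indep-tail }
  ...     | yes c₀≡0 = ⊥-elim (cᵢ≢0 (c≡0 i))
    where
    c≡0 : ∀ i → c i ≡ 0#
    c≡0 zero    = c₀≡0
    c≡0 (suc i) = indep-tail (c ∘ suc) (λ q → begin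
      lin (c ∘ suc) (v ∘ suc) q                ≡⟨ +-identityˡ _ ⟨
      0# + lin (c ∘ suc) (v ∘ suc) q           ≡⟨ cong (_+ lin (c ∘ suc) (v ∘ suc) q)
                                                       (trans (sym (zeroˡ (v zero q))) (cong (_* v zero q) (sym c₀≡0))) ⟩
      lin c v q                                ≡⟨ c·v≡0 q ⟩
      0#                                       ∎) i

  indecomposable⇒circuit : ∀ {ℓ n} (α : Forms ℓ n) → Indecomposable α → 2 ≤ n → Circuit α
  indecomposable⇒circuit {n = suc (suc n)} α indecomposable (s≤s (s≤s _)) with independent-or-circuit _ α
  ... | inj₁ indep = ⊥-elim (indecomposable (independent⇒decomposable α indep))
  ... | inj₂ C     = C

  -- With one nonzero coefficient α_{h 0} would vanish, with two it would be parallel to another form.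
  circuit-support : ∀ {ℓ n} {α : Forms ℓ n} → IsArrangement α → (C : Circuit α) → let open Circuit C in
                    ∃ λ i₁ → ∃ λ i₂ → i₁ ≢ i₂ × c (suc i₁) ≢ 0# × c (suc i₂) ≢ 0#
  circuit-support {α = α} (α≢0 , non-parallel) C with nonzero-or-zero (λ _ → yes tt) (Circuit.c C ∘ suc)
  ... | inj₂ tail≡0 = ⊥-elim (α≢0 (h zero) λ q → x*y≡0⇒y≡0 c₀≢0 (begin
    c zero * α (h zero) q        ≡⟨ +-identityʳ _ ⟨
    c zero * α (h zero) q + 0#   ≡⟨ cong (c zero * α (h zero) q +_)
                                         (Σᶠ-*-zeroˡ (c ∘ suc) (λ i → α (h (suc i)) q) (λ i → tail≡0 i tt)) ⟨
    lin c (α ∘ h) q              ≡⟨ relation q ⟩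
    0#                           ∎))
    where open Circuit C
  ... | inj₁ (i₁ , _ , c₁≢0) with nonzero-or-zero (λ i → ¬? (i ≟ᶠ i₁)) (Circuit.c C ∘ suc)
  ...   | inj₁ (i₂ , i₂≢i₁ , c₂≢0) = i₁ , i₂ , (λ i₁≡i₂ → i₂≢i₁ (sym i₁≡i₂)) , c₁≢0 , c₂≢0
  ...   | inj₂ others≡0 = ⊥-elim (non-parallel (h zero) (h (suc i₁)) (λ h₀≡h₁ → 0≢1+n (h-injective h₀≡h₁))
                                   (- (c₁ * p) , parallel))
    where
    open Circuit C
    c₁ = c (suc i₁)
    p = inv (c zero) c₀≢0
    parallel : ∀ q → α (h zero) q ≡ - (c₁ * p) * α (h (suc i₁)) q
    parallel q = begin
      a
        ≡⟨ *-identityˡ a ⟨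
      1# * a
        ≡⟨ cong (_* a) (trans (*-comm p (c zero)) (x*inv≡1 (c zero) c₀≢0)) ⟨
      p * c zero * a
        ≡⟨ solve 5 (λ p c₀ a c₁ b → p :* c₀ :* a := p :* (c₀ :* a :+ c₁ :* b) :+ :- (c₁ :* p) :* b) refl p (c zero) a c₁ b ⟩
      p * (c zero * a + c₁ * b) + - (c₁ * p) * b
        ≡⟨ cong (λ x → p * (c zero * a + x) + - (c₁ * p) * b) tail≡c₁b ⟨
      p * lin c (α ∘ h) q + - (c₁ * p) * b
        ≡⟨ cong (λ x → p * x + - (c₁ * p) * b) (relation q) ⟩
      p * 0# + - (c₁ * p) * b
        ≡⟨ solve 2 (λ p x → p :* con 0ℤ :+ x := x) refl p (- (c₁ * p) * b) ⟩
      - (c₁ * p) * b ∎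
      where
      a = α (h zero) q
      b = α (h (suc i₁)) q
      tail≡c₁b : Σᶠ (λ i → c (suc i) * α (h (suc i)) q) ≡ c₁ * b
      tail≡c₁b = Σᶠ-single (λ i → c (suc i) * α (h (suc i)) q) i₁
                           (λ i i≢i₁ → trans (cong (_* α (h (suc i)) q) (others≡0 i i≢i₁)) (zeroˡ _))

module Perturbation (R : RealField) where
  open OrderedField R
  open ≡-Reasoning

  -- Closed under decreasing δ, so that finitely many such bounds combine by taking a minimum.
  SmallFor : Carrier → Carrier → Carrier → Set
  SmallFor a b δ = ∀ s {δ′} → 0# < δ′ → δ′ ≤ʳ δ → InHalf s a → InHalf s (a + δ′ * b)

  SmallFor-≤ : ∀ {a b δ₁ δ₂} → δ₁ ≤ʳ δ₂ → SmallFor a b δ₂ → SmallFor a b δ₁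
  SmallFor-≤ δ₁≤δ₂ small s 0<δ′ δ′≤δ₁ = small s 0<δ′ (≤-trans δ′≤δ₁ δ₁≤δ₂)

  x≤y⇒0≤y-x : ∀ {x y} → x ≤ʳ y → InClosedHalf Sign.+ (y + - x)
  x≤y⇒0≤y-x {x} (inj₁ x<y)  = inj₁ (subst (_< _) (-‿inverseʳ x) (+-mono-< (- x) x<y))
  x≤y⇒0≤y-x {x} (inj₂ refl) = inj₂ (-‿inverseʳ x)

  -- For b < 0 the bound δ = a / (a - b) gives a + δ b = a² / (a - b) > 0.
  positive-stays-positive : ∀ {a} b → 0# < a →
                            ∃ λ δ → 0# < δ × ∀ δ′ → 0# < δ′ → δ′ ≤ʳ δ → 0# < a + δ′ * b
  positive-stays-positive {a} b 0<a with compare b 0#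
  ... | tri≈ _ refl _ = 1# , 0<1 , λ δ′ _ _ → InHalf-+ Sign.+ 0<a (inj₂ (zeroʳ δ′))
  ... | tri> _ _ 0<b  = 1# , 0<1 , λ δ′ 0<δ′ _ → InHalf-+ Sign.+ 0<a (inj₁ (*-pos 0<δ′ 0<b))
  ... | tri< b<0 _ _  = δ , *-pos 0<a (0<x⇒0<inv d≢0 0<d) , λ δ′ _ δ′≤δ →
        subst (0# <_) (a+δ′b δ′) (InHalf-+ Sign.+ 0<a+δb (InClosedHalf-* Sign.+ Sign.+ (x≤y⇒0≤y-x δ′≤δ) 0<-b))
    where
    0<-b : 0# < - b
    0<-b = InHalf-neg Sign.- b<0
    d = a + - b
    0<d : 0# < d
    0<d = InHalf-+ Sign.+ 0<a (inj₁ 0<-b)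
    d≢0 = InHalf-≢0 Sign.+ 0<d
    p = inv d d≢0
    δ = a * p
    0<a+δb : 0# < a + δ * b
    0<a+δb = subst (0# <_) (sym (begin
      a + δ * b             ≡⟨ cong (_+ δ * b) (trans (sym (*-identityʳ a)) (cong (a *_) (sym (x*inv≡1 d d≢0)))) ⟩
      a * (d * p) + δ * b   ≡⟨ solve 3 (λ a b p → a :* ((a :- b) :* p) :+ a :* p :* b := a :* a :* p) refl a b p ⟩
      a * a * p             ∎)) (*-pos (0<x*x (InHalf-≢0 Sign.+ 0<a)) (0<x⇒0<inv d≢0 0<d))
    a+δ′b : ∀ δ′ → (a + δ * b) + (δ + - δ′) * - b ≡ a + δ′ * b
    a+δ′b = solve 4 (λ a b δ δ′ → (a :+ δ :* b) :+ (δ :- δ′) :* (:- b) := a :+ δ′ :* b) refl a b δ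

  small-exists : ∀ a b → ∃ λ δ → 0# < δ × SmallFor a b δ
  small-exists a b with compare a 0#
  ... | tri≈ _ refl _ = 1# , 0<1 , λ s _ _ h → ⊥-elim (InHalf-≢0 s h refl)
  ... | tri> _ _ 0<a with positive-stays-positive b 0<a
  ...   | δ , 0<δ , stays = δ , 0<δ , λ s {δ′} 0<δ′ δ′≤δ h →
          subst (λ s → InHalf s (a + δ′ * b)) (InHalf-unique Sign.+ s 0<a h) (stays δ′ 0<δ′ δ′≤δ)
  small-exists a b | tri< a<0 _ _ with positive-stays-positive (- b) (InHalf-neg Sign.- a<0)
  ...   | δ , 0<δ , stays = δ , 0<δ , λ s {δ′} 0<δ′ δ′≤δ h →
          subst (λ s → InHalf s (a + δ′ * b)) (InHalf-unique Sign.- s a<0 h)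
            (InHalf-neg⁻ Sign.- (subst (0# <_) (-a+δ′[-b]≡-[a+δ′b] a δ′ b) (stays δ′ 0<δ′ δ′≤δ)))
    where
    -a+δ′[-b]≡-[a+δ′b] : ∀ a δ′ b → - a + δ′ * - b ≡ - (a + δ′ * b)
    -a+δ′[-b]≡-[a+δ′b] = solve 3 (λ a δ′ b → :- a :+ δ′ :* :- b := :- (a :+ δ′ :* b)) refl

  small-exists-family : ∀ N (a b : Fin N → Carrier) → ∃ λ δ → 0# < δ × ∀ j → SmallFor (a j) (b j) δ
  small-exists-family zero    a b = 1# , 0<1 , λ ()
  small-exists-family (suc N) a b with small-exists (a zero) (b zero) | small-exists-family N (a ∘ suc) (b ∘ suc)
  ... | δ₁ , 0<δ₁ , small₁ | δ₂ , 0<δ₂ , small₂ with ≤-total δ₁ δ₂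
  ...   | inj₁ δ₁≤δ₂ = δ₁ , 0<δ₁ , λ { zero → small₁ ; (suc j) → SmallFor-≤ δ₁≤δ₂ (small₂ j) }
  ...   | inj₂ δ₂≤δ₁ = δ₂ , 0<δ₂ , λ { zero → SmallFor-≤ δ₂≤δ₁ small₁ ; (suc j) → small₂ j }

  small-perturbation : ∀ {N} (a b : Fin N → Carrier) →
                       ∃ λ δ → 0# < δ × ∀ j s → InHalf s (a j) → InHalf s (a j + δ * b j)
  small-perturbation {N} a b with small-exists-family N a b
  ... | δ , 0<δ , small = δ , 0<δ , λ j s → small j s 0<δ (inj₂ refl)

module Complement (R : RealField) where
  open OrderedField R
  open Vectors R
  open Perturbation R
  open ≡-Reasoning

  InComplement : ∀ {ℓ n} → Forms ℓ n → Vect ℓ → Set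
  InComplement α x = ∀ j → ev (α j) x ≢ 0#

  ev-perturb : ∀ {ℓ} (a x u : Vect ℓ) δ → ev a (x +ᵛ δ *ᵛ u) ≡ ev a x + δ * ev a u
  ev-perturb a x u δ = trans (ev-+ᵛ a x (δ *ᵛ u)) (cong (ev a x +_) (ev-*ᵛ a δ u))

  perturb-off-zero : ∀ {ℓ} (a x u : Vect ℓ) {δ} → 0# < δ → ev a x ≡ 0# → ev a u ≢ 0# →
                     ev a (x +ᵛ δ *ᵛ u) ≢ 0#
  perturb-off-zero a x u {δ} 0<δ ax≡0 au≢0 = subst (_≢ 0#) (begin
    δ * ev a u           ≡⟨ +-identityˡ _ ⟨
    0# + δ * ev a u      ≡⟨ cong (_+ δ * ev a u) ax≡0 ⟨
    ev a x + δ * ev a u  ≡⟨ ev-perturb a x u δ ⟨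
    ev a (x +ᵛ δ *ᵛ u)   ∎) (*-≢0 (InHalf-≢0 Sign.+ 0<δ) au≢0)

  generic-point : ∀ {ℓ n} (α : Forms ℓ n) → (∀ j → ¬ (∀ q → α j q ≡ 0#)) → ∃ (InComplement α)
  generic-point {n = zero} α _ = (λ _ → 0#) , λ ()
  generic-point {n = suc n} α α≢0 with generic-point (α ∘ suc) (α≢0 ∘ suc)
  ... | g , g∈M with ev (α zero) g ≟ 0#
  ...   | no α₀g≢0 = g , λ { zero → α₀g≢0 ; (suc j) → g∈M j }
  ...   | yes α₀g≡0 with nonzero-or-zero (λ _ → yes tt) (α zero)
  ...     | inj₂ α₀≡0 = ⊥-elim (α≢0 zero (λ q → α₀≡0 q tt))
  ...     | inj₁ (q , _ , α₀q≢0) with small-perturbation (λ j → ev (α (suc j)) g) (λ j → ev (α (suc j)) (α zero))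
  ...       | δ , 0<δ , keeps = g +ᵛ δ *ᵛ α zero , g′∈M
    where
    g′∈M : InComplement α (g +ᵛ δ *ᵛ α zero)
    g′∈M zero    = perturb-off-zero (α zero) g (α zero) 0<δ α₀g≡0 (InHalf-≢0 Sign.+ (0<ev-self (α zero) q α₀q≢0))
    g′∈M (suc j) = InHalf-≢0 s (subst (InHalf s) (sym (ev-perturb (α (suc j)) g (α zero) δ))
                                      (keeps j s (InHalf-signOf (g∈M j))))
      where s = signOf (ev (α (suc j)) g)

  push-into-complement : ∀ {ℓ n} {α : Forms ℓ n} {g} → InComplement α g → (y : Vect ℓ) →
                         ∃ λ x → InComplement α x × ∀ j s → InHalf s (ev (α j) y) → InHalf s (ev (α j) x)
  push-into-complement {α = α} {g} g∈M y with small-perturbation (λ j → ev (α j) y) (λ j → ev (α j) g)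
  ... | δ , 0<δ , keeps = y +ᵛ δ *ᵛ g , x∈M , keeps′
    where
    keeps′ : ∀ j s → InHalf s (ev (α j) y) → InHalf s (ev (α j) (y +ᵛ δ *ᵛ g))
    keeps′ j s h = subst (InHalf s) (sym (ev-perturb (α j) y g δ)) (keeps j s h)
    x∈M : InComplement α (y +ᵛ δ *ᵛ g)
    x∈M j with ev (α j) y ≟ 0#
    ... | yes αy≡0 = perturb-off-zero (α j) y g 0<δ αy≡0 (g∈M j)
    ... | no αy≢0  = InHalf-≢0 s (keeps′ j s (InHalf-signOf αy≢0))
      where s = signOf (ev (α j) y)

module CircuitRealization (R : RealField) where
  open OrderedField R
  open FiniteSums R
  open Vectors R
  open LinearIndependence R
  open Circuits R
  open Perturbation R
  open Complement R
  open ≡-Reasoning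

  module _ {ℓ n} {α : Forms ℓ n} (C : Circuit α) where
    open Circuit C

    relation-at : ∀ x → Σᶠ (λ z → c z * ev (α (h z)) x) ≡ 0#
    relation-at x = begin
      Σᶠ (λ z → c z * ev (α (h z)) x)  ≡⟨ Σᶠ-cong (λ z → cong (c z *_) (ev-comm (α (h z)) x)) ⟩
      Σᶠ (λ z → c z * ev x (α (h z)))  ≡⟨ ev-lin x c (α ∘ h) ⟨
      ev x (lin c (α ∘ h))             ≡⟨ Σᶠ-zero (λ q → trans (cong (x q *_) (relation q)) (zeroʳ (x q))) ⟩
      0#                               ∎

    -- The target signs τ make c z · α_{h z} have sign ρ z. The point x₁ is nonzero only on
    -- α_{h (suc j)} among the independent forms, so the relation forces the sign at z = 0;
    -- adding a small multiple of u, which has the sign τ on every independent form, fixes the rest.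
    module Realize (ρ : Fin (suc k) → Sign) (j : Fin k) (cⱼ≢0 : c (suc j) ≢ 0#)
                   (ρⱼ≡-ρ₀ : ρ (suc j) ≡ opposite (ρ zero)) where

      τ : Fin (suc k) → Sign
      τ z = signOf (c z) Sign.* ρ z

      target : Fin k → Carrier
      target i with i ≟ᶠ j
      ... | yes _ = sgn (τ (suc j))
      ... | no _  = 0#

      module _ (x₁ : Vect ℓ) (x₁-solves : ∀ i → ev (α (h (suc i))) x₁ ≡ target i) where

        x₁-at-j : InHalf (τ (suc j)) (ev (α (h (suc j))) x₁)
        x₁-at-j with j ≟ᶠ j | x₁-solves j
        ... | yes _  | x₁ⱼ≡sgn = subst (InHalf (τ (suc j))) (sym x₁ⱼ≡sgn) (InHalf-sgn (τ (suc j)))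
        ... | no j≢j | _       = ⊥-elim (j≢j refl)

        x₁-off-j : ∀ i → i ≢ j → ev (α (h (suc i))) x₁ ≡ 0#
        x₁-off-j i i≢j with i ≟ᶠ j | x₁-solves i
        ... | yes i≡j | _     = ⊥-elim (i≢j i≡j)
        ... | no _    | x₁ᵢ≡0 = x₁ᵢ≡0

        x₁-at-zero : InHalf (τ zero) (ev (α (h zero)) x₁)
        x₁-at-zero = InHalf-cancelˡ (ρ zero) c₀≢0 (subst (InHalf (ρ zero)) -cⱼaⱼ≡c₀a₀ -cⱼaⱼ-sign)
          where
          aⱼ = ev (α (h (suc j))) x₁
          cⱼaⱼ-sign : InHalf (ρ (suc j)) (c (suc j) * aⱼ)
          cⱼaⱼ-sign = subst (λ s → InHalf s (c (suc j) * aⱼ)) (s*[s*t]≡t (signOf (c (suc j))) (ρ (suc j)))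
                            (InHalf-* (signOf (c (suc j))) (τ (suc j)) (InHalf-signOf cⱼ≢0) x₁-at-j)
          -cⱼaⱼ-sign : InHalf (ρ zero) (- (c (suc j) * aⱼ))
          -cⱼaⱼ-sign = subst (λ s → InHalf s (- (c (suc j) * aⱼ)))
                             (trans (cong opposite ρⱼ≡-ρ₀) (Sign.opposite-involutive (ρ zero)))
                             (InHalf-neg (ρ (suc j)) cⱼaⱼ-sign)
          A = c zero * ev (α (h zero)) x₁
          T = Σᶠ (λ i → c (suc i) * ev (α (h (suc i))) x₁)
          -cⱼaⱼ≡c₀a₀ : - (c (suc j) * aⱼ) ≡ A
          -cⱼaⱼ≡c₀a₀ = begin
            - (c (suc j) * aⱼ)  ≡⟨ cong -_ (Σᶠ-single (λ i → c (suc i) * ev (α (h (suc i))) x₁) j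
                                     (λ i i≢j → trans (cong (c (suc i) *_) (x₁-off-j i i≢j)) (zeroʳ _))) ⟨
            - T                 ≡⟨ +-identityˡ (- T) ⟨
            0# + - T            ≡⟨ cong (_+ - T) (relation-at x₁) ⟨
            (A + T) + - T       ≡⟨ solve 2 (λ A T → (A :+ T) :- T := A) refl A T ⟩
            A                   ∎

        module _ (u : Vect ℓ) (u-solves : ∀ i → ev (α (h (suc i))) u ≡ sgn (τ (suc i))) where

          signs-realizable : ∃ λ y → ∀ z → InHalf (τ z) (ev (α (h z)) y)
          signs-realizable with small-perturbation (λ z → ev (α (h z)) x₁) (λ z → ev (α (h z)) u)
          ... | δ , 0<δ , keeps = x₁ +ᵛ δ *ᵛ u , y-signs
            where
            y-signs : ∀ z → InHalf (τ z) (ev (α (h z)) (x₁ +ᵛ δ *ᵛ u))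
            y-signs zero = subst (InHalf (τ zero)) (sym (ev-perturb _ x₁ u δ)) (keeps zero (τ zero) x₁-at-zero)
            y-signs (suc i) with i ≟ᶠ j
            ... | yes refl = subst (InHalf (τ (suc i))) (sym (ev-perturb _ x₁ u δ)) (keeps (suc i) (τ (suc i)) x₁-at-j)
            ... | no i≢j   = subst (InHalf (τ (suc i))) (sym y-value)
                                   (InHalf-* Sign.+ (τ (suc i)) 0<δ (InHalf-sgn (τ (suc i))))
              where
              y-value : ev (α (h (suc i))) (x₁ +ᵛ δ *ᵛ u) ≡ δ * sgn (τ (suc i))
              y-value = begin
                ev (α (h (suc i))) (x₁ +ᵛ δ *ᵛ u)                  ≡⟨ ev-perturb _ x₁ u δ ⟩
                ev (α (h (suc i))) x₁ + δ * ev (α (h (suc i))) u   ≡⟨ cong₂ (λ a b → a + δ * b) (x₁-off-j i i≢j) (u-solves i) ⟩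
                0# + δ * sgn (τ (suc i))                           ≡⟨ +-identityˡ _ ⟩
                δ * sgn (τ (suc i))                                ∎

    realize : ∀ {g} → InComplement α g → (ρ : Fin (suc k) → Sign) (j : Fin k) →
              c (suc j) ≢ 0# → ρ (suc j) ≡ opposite (ρ zero) →
              ∃ λ x → InComplement α x × ∀ z → InHalf (signOf (c z) Sign.* ρ z) (ev (α (h z)) x)
    realize g∈M ρ j cⱼ≢0 ρⱼ≡-ρ₀
      with solve-linear-system (α ∘ h ∘ suc) independent (Realize.target ρ j cⱼ≢0 ρⱼ≡-ρ₀)
         | solve-linear-system (α ∘ h ∘ suc) independent (λ i → sgn (Realize.τ ρ j cⱼ≢0 ρⱼ≡-ρ₀ (suc i)))
    ... | x₁ , x₁-solves | u , u-solves with Realize.signs-realizable ρ j cⱼ≢0 ρⱼ≡-ρ₀ x₁ x₁-solves u u-solves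
    ... | y , y-signs with push-into-complement g∈M y
    ... | x , x∈M , keeps = x , x∈M , λ z → keeps (h z) (signOf (c z) Sign.* ρ z) (y-signs z)

module AdmissibleMaps (R : RealField) where
  open OrderedField R
  open FiniteSums R
  open Vectors R
  open Circuits R
  open Complement R
  open CircuitRealization R
  open ≡-Reasoning

  module Admissible {ℓ n m} {α : Forms ℓ n} (Φ : (Fin m → Ch α) → Ch α) (φ : (Fin m → Sign) → Sign)
                    (Φ-admissible : ∀ j σ (C : Fin m → Ch α) → ε j σ (Φ C) ≡ φ (λ i → ε j σ (C i))) where

    -- Whether a hyperplane is some h z is decided independently of i, so `chamber-signs` is an
    -- equality of functions Fin m → Sign, as φ needs, without function extensionality.
    module PrescribedChambers {K} (h : Fin K → Fin n) (h-injective : ∀ {z z′} → h z ≡ h z′ → z ≡ z′)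
                              (σ : Fin K → Fin m → Sign) (point : Fin m → Vect ℓ)
                              (point∈M : ∀ i → InComplement α (point i))
                              (point-signs : ∀ i z → InHalf (σ z i) (ev (α (h z)) (point i))) where

      sign : ∀ j → Dec (∃ λ z → h z ≡ j) → Fin m → Sign
      sign j (yes (z , _)) i = σ z i
      sign j (no _)        i = signOf (ev (α j) (point i))

      sign-correct : ∀ j d i → InHalf (sign j d i) (ev (α j) (point i))
      sign-correct j (yes (z , refl)) i = point-signs i z
      sign-correct j (no _)           i = InHalf-signOf (point∈M i j)

      h? : ∀ j → Dec (∃ λ z → h z ≡ j)
      h? j = any? (λ z → h z ≟ᶠ j)

      chamber : Fin m → Ch α
      chamber i = (λ j → sign j (h? j) i) , point i , λ j → sign-correct j (h? j) i

      chamber-signs : ∀ z → (λ i → sign (h z) (h? (h z)) i) ≡ σ z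
      chamber-signs z with h? (h z)
      ... | yes (z′ , hz′≡hz) = cong σ (h-injective hz′≡hz)
      ... | no ∄z             = ⊥-elim (∄z (z , refl))

      output : Vect ℓ
      output = proj₁ (proj₂ (Φ chamber))

      output-signs : ∀ z → InHalf (φ (σ z)) (ev (α (h z)) output)
      output-signs z = subst (λ s → InHalf s (ev (α (h z)) output))
        (trans (Φ-admissible (h z) Sign.+ chamber) (cong φ (chamber-signs z)))
        (proj₂ (proj₂ (Φ chamber)) (h z))

      φ-opposite : ∀ z → φ (λ i → opposite (σ z i)) ≡ opposite (φ (σ z))
      φ-opposite z = begin
        φ (λ i → opposite (σ z i))                       ≡⟨ cong (λ f → φ (λ i → opposite (f i))) (chamber-signs z) ⟨
        φ (λ i → ε (h z) Sign.- (chamber i))             ≡⟨ Φ-admissible (h z) Sign.- chamber ⟨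
        opposite (ε (h z) Sign.+ (Φ chamber))            ≡⟨ cong opposite (Φ-admissible (h z) Sign.+ chamber) ⟩
        opposite (φ (λ i → ε (h z) Sign.+ (chamber i)))  ≡⟨ cong (λ f → opposite (φ f)) (chamber-signs z) ⟩
        opposite (φ (σ z))                               ∎

    φ-odd : ∀ {g} → InComplement α g → Fin n → ∀ x → φ (λ i → opposite (x i)) ≡ opposite (φ x)
    φ-odd {g} g∈M j x =
      PrescribedChambers.φ-opposite {K = 1} (λ _ → j) (λ { {zero} {zero} _ → refl }) (λ _ → x)
        point point∈M (λ i _ → point-sign i) zero
      where
      s = signOf (ev (α j) g)
      point : Fin m → Vect ℓ
      point i = sgn (x i Sign.* s) *ᵛ g
      point∈M : ∀ i → InComplement α (point i)
      point∈M i j′ = subst (_≢ 0#) (sym (ev-*ᵛ (α j′) _ g))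
                           (*-≢0 (InHalf-≢0 (x i Sign.* s) (InHalf-sgn (x i Sign.* s))) (g∈M j′))
      point-sign : ∀ i → InHalf (x i) (ev (α j) (point i))
      point-sign i = subst₂ InHalf ([t*s]*s≡t (x i) s) (sym (ev-*ᵛ (α j) _ g))
                       (InHalf-* (x i Sign.* s) s (InHalf-sgn (x i Sign.* s)) (InHalf-signOf (g∈M j)))

    module _ {g} (g∈M : InComplement α g) (C : Circuit α) where
      open Circuit C

      φ-twist : ∀ o x → φ (λ i → o Sign.* x i) ≡ o Sign.* φ x
      φ-twist Sign.+ x = refl
      φ-twist Sign.- x = φ-odd g∈M (h zero) x

      module _ (rows : Fin (suc k) → Fin m → Sign) (t : Sign) (φ-rows≡t : ∀ z → φ (rows z) ≡ t)
               (point : Fin m → Vect ℓ) (point∈M : ∀ i → InComplement α (point i))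
               (point-signs : ∀ i z → InHalf (signOf (c z) Sign.* rows z i) (ev (α (h z)) (point i))) where
        open PrescribedChambers h h-injective (λ z i → signOf (c z) Sign.* rows z i) point point∈M point-signs

        output-sign : ∀ z → InHalf (signOf (c z) Sign.* t) (ev (α (h z)) output)
        output-sign z = subst (λ s → InHalf s (ev (α (h z)) output))
          (trans (φ-twist (signOf (c z)) (rows z)) (cong (signOf (c z) Sign.*_) (φ-rows≡t z)))
          (output-signs z)

        term-sign-strict : ∀ {z} → c z ≢ 0# → InHalf t (c z * ev (α (h z)) output)
        term-sign-strict {z} c≢0 = subst (λ s → InHalf s (c z * ev (α (h z)) output)) (s*[s*t]≡t (signOf (c z)) t)
          (InHalf-* (signOf (c z)) (signOf (c z) Sign.* t) (InHalf-signOf c≢0) (output-sign z))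

        term-sign : ∀ z → InClosedHalf t (c z * ev (α (h z)) output)
        term-sign z with c z ≟ 0#
        ... | yes c≡0 = inj₂ (trans (cong (_* ev (α (h z)) output) c≡0) (zeroˡ (ev (α (h z)) output)))
        ... | no c≢0  = inj₁ (term-sign-strict c≢0)

        realized-rows-not-constant : ⊥
        realized-rows-not-constant = InHalf-≢0 t
          (Σᶠ-InHalf t (λ z → c z * ev (α (h z)) output) zero term-sign (term-sign-strict c₀≢0))
          (relation-at C output)

      φ-not-constant-on-circuit : (rows : Fin (suc k) → Fin m → Sign) →
        (∀ i → ∃ λ j → c (suc j) ≢ 0# × rows (suc j) i ≡ opposite (rows zero i)) →
        ∀ t → ¬ (∀ z → φ (rows z) ≡ t)
      φ-not-constant-on-circuit rows opposed t φ-rows≡t = realized-rows-not-constant rows t φ-rows≡t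
        (proj₁ ∘ column) (proj₁ ∘ proj₂ ∘ column) (proj₂ ∘ proj₂ ∘ column)
        where
        column : ∀ i → ∃ λ x → InComplement α x × ∀ z → InHalf (signOf (c z) Sign.* rows z i) (ev (α (h z)) x)
        column i = realize C g∈M (λ z → rows z i) (proj₁ (opposed i)) (proj₁ (proj₂ (opposed i)))
                                                  (proj₂ (proj₂ (opposed i)))

      φ-not-unanimous : IsArrangement α → (A B D : Fin m → Sign) → NowhereUnanimous A B D →
                        ∀ t → φ A ≡ t → φ B ≡ t → φ D ≡ t → ⊥
      φ-not-unanimous arrangement A B D opposed t φA≡t φB≡t φD≡t with circuit-support arrangement C
      ... | i₁ , i₂ , i₁≢i₂ , c₁≢0 , c₂≢0 = φ-not-constant-on-circuit rows rows-opposed t φ-rows≡t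
        where
        rows : Fin (suc k) → Fin m → Sign
        rows zero = A
        rows (suc i) with i ≟ᶠ i₁
        ... | yes _ = B
        ... | no _  = D

        rows-i₁ : rows (suc i₁) ≡ B
        rows-i₁ with i₁ ≟ᶠ i₁
        ... | yes _    = refl
        ... | no i₁≢i₁ = ⊥-elim (i₁≢i₁ refl)

        rows-i₂ : rows (suc i₂) ≡ D
        rows-i₂ with i₂ ≟ᶠ i₁
        ... | yes i₂≡i₁ = ⊥-elim (i₁≢i₂ (sym i₂≡i₁))
        ... | no _      = refl

        rows-opposed : ∀ i → ∃ λ j → c (suc j) ≢ 0# × rows (suc j) i ≡ opposite (A i)
        rows-opposed i with opposed i
        ... | inj₁ Bᵢ≡-Aᵢ = i₁ , c₁≢0 , trans (cong (λ r → r i) rows-i₁) Bᵢ≡-Aᵢ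
        ... | inj₂ Dᵢ≡-Aᵢ = i₂ , c₂≢0 , trans (cong (λ r → r i) rows-i₂) Dᵢ≡-Aᵢ

        φ-rows≡t : ∀ z → φ (rows z) ≡ t
        φ-rows≡t zero = φA≡t
        φ-rows≡t (suc i) with i ≟ᶠ i₁
        ... | yes _ = φB≡t
        ... | no _  = φD≡t

module K-Properties (R : RealField) where
  open OrderedField R
  open Circuits R
  open Complement R
  open AdmissibleMaps R

  module FromCircuit {ℓ n m} {α : Forms ℓ n} (arrangement : IsArrangement α) (C : Circuit α)
                     (Φ : (Fin m → Ch α) → Ch α) (φ : (Fin m → Sign) → Sign)
                     (associated : IsAssociatedFamily α Φ (λ j σ → φ)) where
    open Admissible Φ φ (proj₂ associated)

    j₀ = Circuit.h C zero
    g∈M = proj₂ (generic-point α (proj₁ arrangement))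

    φ-opposite-pointwise : ∀ A B → (∀ i → B i ≡ opposite (A i)) → φ B ≡ opposite (φ A)
    φ-opposite-pointwise A B B≡-A = ≢⇒≡opposite λ φB≡φA →
      φ-not-unanimous g∈M C arrangement A B B (inj₁ ∘ B≡-A) (φ A) refl φB≡φA φB≡φA

    φ-all-minus : φ (λ _ → Sign.-) ≡ Sign.-
    φ-all-minus = trans (φ-odd g∈M j₀ allPlus) (cong opposite (proj₁ associated j₀ Sign.+))

    -- ⊤ ₊ is only pointwise equal to allPlus, and φ need not respect pointwise equality.
    InK-⊤ : InK φ ⊤
    InK-⊤ = trans (φ-opposite-pointwise (λ _ → Sign.-) (⊤ ₊) ⊤₊≡+) (cong opposite φ-all-minus)

    InK-∁ : ∀ S → InK φ S ⇔ (¬ InK φ (∁ S))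
    InK-∁ S = subst (λ s → InK φ S ⇔ (¬ s ≡ Sign.+)) (sym (φ-opposite-pointwise (S ₊) (∁ S ₊) (∁₊≡opposite S)))
                    (≡+⇔opposite≢+ (φ (S ₊)))

    InK-∩ : ∀ S₁ S₂ → InK φ S₁ → InK φ S₂ → InK φ (S₁ ∩ S₂)
    InK-∩ S₁ S₂ φS₁≡+ φS₂≡+ = ≢⇒≡opposite λ φS₁∩S₂≡- →
      φ-not-unanimous g∈M C arrangement (S₁ ₊) (S₂ ₊) (λ i → opposite (((S₁ ∩ S₂) ₊) i))
        (∩₊-nowhere-unanimous S₁ S₂) Sign.+ φS₁≡+ φS₂≡+
        (trans (φ-odd g∈M j₀ ((S₁ ∩ S₂) ₊)) (cong opposite φS₁∩S₂≡-))

lemma3p5 : (R : RealField) → let open Arrangements R in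
    ∀ (ℓ n m : ℕ) (α : Forms ℓ n) → IsArrangement α → Indecomposable α → 3 ≤ n → 1 ≤ m →
    (Φ : (Fin m → Ch α) → Ch α) (φ : (Fin m → Sign) → Sign) →
    IsAssociatedFamily α Φ (λ j σ → φ) →
    InK φ ⊤ × (∀ S → InK φ S ⇔ (¬ InK φ (∁ S))) × (∀ S₁ S₂ → InK φ S₁ → InK φ S₂ → InK φ (S₁ ∩ S₂))
lemma3p5 R ℓ n m α arrangement indecomposable 3≤n _ Φ φ associated = InK-⊤ , InK-∁ , InK-∩
  where
  open Circuits R using (indecomposable⇒circuit)
  open K-Properties R
  open FromCircuit arrangement (indecomposable⇒circuit α indecomposable (ℕ.<⇒≤ 3≤n)) Φ φ associated
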